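{- Let $m\ge 1$ and let $a,b_1,\dots,b_m$ be positive integers with $\gcd(a,b_1,\dots,b_m)=1$, where for each $j\in\{1,\dots,m\}$ we write $b_j=ak_j+\ell_j$ with $k_j\in\mathbb{N}$ and $\ell_j\in\{1,\dots,a-1\}$ (so in particular $a\nmid b_j$). Then the set of points $(x_1,\dots,x_{a-1})\in\mathbb{R}^{a-1}$ satisfying the following inequalities is a polytope (in particular it is bounded), and there is a bijection between the set of $(a,b_1,\dots,b_m)$-core partitions and the set of integer points of this polytope: \[ \begin{aligned} x_{\ell_j} &\le k_j && \text{for all } j\in\{1,\dots,m\},\\ x_{i+\ell_j} &\le k_j+x_i && \text{for all } j\in\{1,\dots,m\},\ i\in\{1,\dots,a-1\} \text{ with } i+\ell_j<a,\\ x_{i+\ell_j-a} &\le k_j+x_i+1 && \text{for all } j\in\{1,\dots,m\},\ i\in\{1,\dots,a-1\} \text{ with } i+\ell_j>a,\\ x_i &\ge 0 && \text{for all } i\in\{1,\dots,a-1\}. \end{aligned} \]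
   Context: $\mathbb{N}=\{0,1,2,\dots\}$. A partition is a finite (possibly empty) weakly decreasing sequence of positive integers, represented by its Young diagram. The hook length of a box is the number of boxes directly to its right plus the number directly below it plus one. A partition is an $a$-core if none of its hook lengths is divisible by $a$, and an $(a,b_1,\dots,b_m)$-core if it is an $a$-core and a $b_j$-core for every $j$. -}

module Defs where

open import Data.Fin.Base using (Fin; toℕ)
open import Data.Integer.Base as ℤ using (ℤ; +_)
open import Data.List.Base as List using (List; drop; filter; length; lookup)
open import Data.List.Relation.Unary.All using (All)
open import Data.List.Relation.Unary.Linked using (Linked)
open import Data.Nat.Base as ℕ using (ℕ; suc; _∸_; _⊔_)
import Data.Nat.Properties as ℕ
open import Data.Nat.Divisibility using (_∣_)
open import Data.Nat.GCD using (gcd)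
open import Data.Product.Base using (Σ; ∃-syntax; _×_; _,_; proj₁)
open import Data.Rational.Base as ℚ using (ℚ; 0ℚ; 1ℚ; ½; ∣_∣)
import Data.Rational.Properties as ℚ
open import Data.Rational.Solver using (module +-*-Solver)
open import Data.Vec.Functional as Vector using (Vector)
open import Function.Bundles using (_⇔_)
open import Level using (0ℓ)
open import Relation.Binary.Bundles using (Setoid)
import Relation.Binary.Construct.On as On
open import Relation.Binary.PropositionalEquality
  using (_≡_; refl; sym; trans; cong; subst; setoid; _→-setoid_)
open import Relation.Nullary using (¬_)
open import Relation.Unary using (Pred)

-- Real numbers, as Cauchy sequences of rationals.  Two sequences denote
-- the same real when each is _≤_ the other; all operations are pointwise.

IsCauchy : (ℕ → ℚ) → Set
IsCauchy f = ∀ ε → 0ℚ ℚ.< ε →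
  ∃[ N ] (∀ m n → N ℕ.≤ m → N ℕ.≤ n → ∣ f m ℚ.- f n ∣ ℚ.≤ ε)

record ℝ : Set where
  constructor mkℝ
  field
    seq    : ℕ → ℚ
    cauchy : IsCauchy seq

open ℝ public

infix 4 _≤_
_≤_ : ℝ → ℝ → Set
x ≤ y = ∀ ε → 0ℚ ℚ.< ε → ∃[ N ] (∀ n → N ℕ.≤ n → seq x n ℚ.≤ seq y n ℚ.+ ε)

fromℚ : ℚ → ℝ
fromℚ q = mkℝ (λ _ → q) λ ε 0<ε → 0 , λ _ _ _ _ →
  subst (ℚ._≤ ε) (sym (cong ∣_∣ (ℚ.+-inverseʳ q))) (ℚ.<⇒≤ 0<ε)

fromℤ : ℤ → ℝ
fromℤ z = fromℚ (z ℚ./ 1)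

fromℕ : ℕ → ℝ
fromℕ n = fromℤ (+ n)

0ℝ 1ℝ : ℝ
0ℝ = fromℕ 0
1ℝ = fromℕ 1

private
  open +-*-Solver using (solve; _:+_; _:*_; _:-_; :-_; _:=_)

  abstract
    half : ∀ ε → 0ℚ ℚ.< ε → 0ℚ ℚ.< ½ ℚ.* ε
    half ε 0<ε = subst (ℚ._< ½ ℚ.* ε) (ℚ.*-zeroʳ ½) (ℚ.*-monoʳ-<-pos ½ 0<ε)

    half+half : ∀ ε → ½ ℚ.* ε ℚ.+ ½ ℚ.* ε ≡ ε
    half+half ε = trans (sym (ℚ.*-distribʳ-+ ε ½ ½)) (ℚ.*-identityˡ ε)

    +-cauchy : ∀ f g → IsCauchy f → IsCauchy g → IsCauchy (λ n → f n ℚ.+ g n)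
    +-cauchy f g cf cg ε 0<ε with cf (½ ℚ.* ε) (half ε 0<ε) | cg (½ ℚ.* ε) (half ε 0<ε)
    ... | M , p | N , q = M ⊔ N , λ m n M⊔N≤m M⊔N≤n → begin
      ∣ (f m ℚ.+ g m) ℚ.- (f n ℚ.+ g n) ∣
        ≡⟨ cong ∣_∣ (solve 4 (λ a b c d →
             (a :+ b) :- (c :+ d) := (a :- c) :+ (b :- d)) refl (f m) (g m) (f n) (g n)) ⟩
      ∣ (f m ℚ.- f n) ℚ.+ (g m ℚ.- g n) ∣
        ≤⟨ ℚ.∣p+q∣≤∣p∣+∣q∣ (f m ℚ.- f n) (g m ℚ.- g n) ⟩
      ∣ f m ℚ.- f n ∣ ℚ.+ ∣ g m ℚ.- g n ∣
        ≤⟨ ℚ.+-mono-≤ (p m n (ℕ.m⊔n≤o⇒m≤o M N M⊔N≤m) (ℕ.m⊔n≤o⇒m≤o M N M⊔N≤n))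
                      (q m n (ℕ.m⊔n≤o⇒n≤o M N M⊔N≤m) (ℕ.m⊔n≤o⇒n≤o M N M⊔N≤n)) ⟩
      ½ ℚ.* ε ℚ.+ ½ ℚ.* ε
        ≡⟨ half+half ε ⟩
      ε ∎
      where open ℚ.≤-Reasoning

    neg-cauchy : ∀ f → IsCauchy f → IsCauchy (λ n → ℚ.- f n)
    neg-cauchy f cf ε 0<ε with cf ε 0<ε
    ... | N , p = N , λ m n N≤m N≤n → subst (ℚ._≤ ε)
      (trans (sym (ℚ.∣-p∣≡∣p∣ (f m ℚ.- f n)))
             (cong ∣_∣ (solve 2 (λ a b → :- (a :- b) := (:- a) :- (:- b)) refl (f m) (f n))))
      (p m n N≤m N≤n)

    bounded : ∀ {f} → IsCauchy f → ∃[ B ] ∃[ N ] (0ℚ ℚ.< B × (∀ n → N ℕ.≤ n → ∣ f n ∣ ℚ.≤ B))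
    bounded {f} cf with cf 1ℚ (ℚ.positive⁻¹ 1ℚ)
    ... | N , p = 1ℚ ℚ.+ ∣ f N ∣ , N
      , ℚ.+-mono-<-≤ (ℚ.positive⁻¹ 1ℚ) (ℚ.0≤∣p∣ (f N))
      , λ n N≤n → begin
        ∣ f n ∣
          ≡⟨ cong ∣_∣ (solve 2 (λ a b → a := (a :- b) :+ b) refl (f n) (f N)) ⟩
        ∣ (f n ℚ.- f N) ℚ.+ f N ∣
          ≤⟨ ℚ.∣p+q∣≤∣p∣+∣q∣ (f n ℚ.- f N) (f N) ⟩
        ∣ f n ℚ.- f N ∣ ℚ.+ ∣ f N ∣
          ≤⟨ ℚ.+-monoˡ-≤ ∣ f N ∣ (p n N N≤n ℕ.≤-refl) ⟩
        1ℚ ℚ.+ ∣ f N ∣ ∎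
      where open ℚ.≤-Reasoning

    ∣*∣-mono : ∀ a b B δ → 0ℚ ℚ.< B → ∣ a ∣ ℚ.≤ B → ∣ b ∣ ℚ.≤ δ → ∣ a ℚ.* b ∣ ℚ.≤ B ℚ.* δ
    ∣*∣-mono a b B δ 0<B a≤B b≤δ = begin
      ∣ a ℚ.* b ∣       ≡⟨ ℚ.∣p*q∣≡∣p∣*∣q∣ a b ⟩
      ∣ a ∣ ℚ.* ∣ b ∣   ≤⟨ ℚ.*-monoʳ-≤-nonNeg ∣ b ∣ {{ℚ.∣-∣-nonNeg b}} a≤B ⟩
      B ℚ.* ∣ b ∣       ≤⟨ ℚ.*-monoˡ-≤-nonNeg B {{ℚ.nonNegative (ℚ.<⇒≤ 0<B)}} b≤δ ⟩
      B ℚ.* δ           ∎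
      where open ℚ.≤-Reasoning

    product-estimate : ∀ a b c d B C δ → 0ℚ ℚ.< B → 0ℚ ℚ.< C →
      ∣ a ∣ ℚ.≤ B → ∣ d ∣ ℚ.≤ C → ∣ a ℚ.- c ∣ ℚ.≤ δ → ∣ b ℚ.- d ∣ ℚ.≤ δ →
      ∣ a ℚ.* b ℚ.- c ℚ.* d ∣ ℚ.≤ (B ℚ.+ C) ℚ.* δ
    product-estimate a b c d B C δ 0<B 0<C a≤B d≤C ac≤δ bd≤δ = begin
      ∣ a ℚ.* b ℚ.- c ℚ.* d ∣
        ≡⟨ cong ∣_∣ (solve 4 (λ a b c d →
             a :* b :- c :* d := a :* (b :- d) :+ d :* (a :- c)) refl a b c d) ⟩
      ∣ a ℚ.* (b ℚ.- d) ℚ.+ d ℚ.* (a ℚ.- c) ∣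
        ≤⟨ ℚ.∣p+q∣≤∣p∣+∣q∣ (a ℚ.* (b ℚ.- d)) (d ℚ.* (a ℚ.- c)) ⟩
      ∣ a ℚ.* (b ℚ.- d) ∣ ℚ.+ ∣ d ℚ.* (a ℚ.- c) ∣
        ≤⟨ ℚ.+-mono-≤ (∣*∣-mono a (b ℚ.- d) B δ 0<B a≤B bd≤δ)
                      (∣*∣-mono d (a ℚ.- c) C δ 0<C d≤C ac≤δ) ⟩
      B ℚ.* δ ℚ.+ C ℚ.* δ
        ≡⟨ sym (ℚ.*-distribʳ-+ δ B C) ⟩
      (B ℚ.+ C) ℚ.* δ ∎
      where open ℚ.≤-Reasoning

    divide : ∀ S ε → 0ℚ ℚ.< S → 0ℚ ℚ.< ε → ∃[ δ ] (0ℚ ℚ.< δ × S ℚ.* δ ≡ ε)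
    divide S ε 0<S 0<ε = S⁻¹ ℚ.* ε
      , subst (ℚ._< S⁻¹ ℚ.* ε) (ℚ.*-zeroʳ S⁻¹) (ℚ.*-monoʳ-<-pos S⁻¹ {{ℚ.1/pos⇒pos S {{S-pos}}}} 0<ε)
      , trans (sym (ℚ.*-assoc S S⁻¹ ε))
              (trans (cong (ℚ._* ε) (ℚ.*-inverseʳ S {{S-nonZero}})) (ℚ.*-identityˡ ε))
      where
      S-pos : ℚ.Positive S
      S-pos = ℚ.positive 0<S
      S-nonZero : ℚ.NonZero S
      S-nonZero = ℚ.pos⇒nonZero S {{S-pos}}
      S⁻¹ : ℚ
      S⁻¹ = (ℚ.1/ S) {{S-nonZero}}

    *-cauchy : ∀ f g → IsCauchy f → IsCauchy g → IsCauchy (λ n → f n ℚ.* g n)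
    *-cauchy f g cf cg ε 0<ε =
      let B , N₁ , 0<B , f≤B = bounded cf
          C , N₂ , 0<C , g≤C = bounded cg
          δ , 0<δ , [B+C]δ≡ε = divide (B ℚ.+ C) ε (ℚ.+-mono-< 0<B 0<C) 0<ε
          N₃ , p = cf δ 0<δ
          N₄ , q = cg δ 0<δ
      in combine B N₁ 0<B f≤B C N₂ 0<C g≤C δ [B+C]δ≡ε N₃ p N₄ q
      where
      combine : ∀ B N₁ → 0ℚ ℚ.< B → (∀ n → N₁ ℕ.≤ n → ∣ f n ∣ ℚ.≤ B) →
                ∀ C N₂ → 0ℚ ℚ.< C → (∀ n → N₂ ℕ.≤ n → ∣ g n ∣ ℚ.≤ C) →
                ∀ δ → (B ℚ.+ C) ℚ.* δ ≡ ε →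
                ∀ N₃ → (∀ m n → N₃ ℕ.≤ m → N₃ ℕ.≤ n → ∣ f m ℚ.- f n ∣ ℚ.≤ δ) →
                ∀ N₄ → (∀ m n → N₄ ℕ.≤ m → N₄ ℕ.≤ n → ∣ g m ℚ.- g n ∣ ℚ.≤ δ) →
                ∃[ N ] (∀ m n → N ℕ.≤ m → N ℕ.≤ n → ∣ f m ℚ.* g m ℚ.- f n ℚ.* g n ∣ ℚ.≤ ε)
      combine B N₁ 0<B f≤B C N₂ 0<C g≤C δ [B+C]δ≡ε N₃ p N₄ q =
        (N₁ ⊔ N₂) ⊔ (N₃ ⊔ N₄) , λ m n N≤m N≤n →
          subst (∣ f m ℚ.* g m ℚ.- f n ℚ.* g n ∣ ℚ.≤_) [B+C]δ≡ε
            (product-estimate (f m) (g m) (f n) (g n) B C δ 0<B 0<C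
              (f≤B m (ℕ.m⊔n≤o⇒m≤o N₁ N₂ (left N≤m)))
              (g≤C n (ℕ.m⊔n≤o⇒n≤o N₁ N₂ (left N≤n)))
              (p m n (ℕ.m⊔n≤o⇒m≤o N₃ N₄ (right N≤m)) (ℕ.m⊔n≤o⇒m≤o N₃ N₄ (right N≤n)))
              (q m n (ℕ.m⊔n≤o⇒n≤o N₃ N₄ (right N≤m)) (ℕ.m⊔n≤o⇒n≤o N₃ N₄ (right N≤n))))
        where
        left : ∀ {m} → (N₁ ⊔ N₂) ⊔ (N₃ ⊔ N₄) ℕ.≤ m → N₁ ⊔ N₂ ℕ.≤ m
        left = ℕ.m⊔n≤o⇒m≤o (N₁ ⊔ N₂) (N₃ ⊔ N₄)
        right : ∀ {m} → (N₁ ⊔ N₂) ⊔ (N₃ ⊔ N₄) ℕ.≤ m → N₃ ⊔ N₄ ℕ.≤ m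
        right = ℕ.m⊔n≤o⇒n≤o (N₁ ⊔ N₂) (N₃ ⊔ N₄)

infixl 6 _+_
infixl 7 _*_
infix  8 -_

_+_ : ℝ → ℝ → ℝ
x + y = mkℝ (λ n → seq x n ℚ.+ seq y n) (+-cauchy (seq x) (seq y) (cauchy x) (cauchy y))

-_ : ℝ → ℝ
- x = mkℝ (λ n → ℚ.- seq x n) (neg-cauchy (seq x) (cauchy x))

_*_ : ℝ → ℝ → ℝ
x * y = mkℝ (λ n → seq x n ℚ.* seq y n) (*-cauchy (seq x) (seq y) (cauchy x) (cauchy y))

-- A polytope in ℝᵈ is a bounded intersection of finitely many closed
-- half-spaces { x | A s ∙ x ≤ c s }.

infix 7 _∙_
_∙_ : ∀ {d} → Vector ℝ d → Vector ℝ d → ℝ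
u ∙ v = Vector.foldr _+_ 0ℝ (Vector.zipWith _*_ u v)

IsPolyhedron : ∀ {d} → Pred (Vector ℝ d) 0ℓ → Set
IsPolyhedron {d} P =
  ∃[ r ] Σ (Vector (Vector ℝ d) r) λ A → Σ (Vector ℝ r) λ c →
    ∀ x → P x ⇔ (∀ s → A s ∙ x ≤ c s)

IsBounded : ∀ {d} → Pred (Vector ℝ d) 0ℓ → Set
IsBounded P = ∃[ B ] (∀ x → P x → ∀ i → - B ≤ x i × x i ≤ B)

IsPolytope : ∀ {d} → Pred (Vector ℝ d) 0ℓ → Set
IsPolytope P = IsPolyhedron P × IsBounded P

IntegerPoint : ∀ {d} → Pred (Vector ℝ d) 0ℓ → Set
IntegerPoint {d} P = Σ (Vector ℤ d) λ z → P (Vector.map fromℤ z)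

integerPoints : ∀ {d} → Pred (Vector ℝ d) 0ℓ → Setoid 0ℓ 0ℓ
integerPoints {d} P = On.setoid (Fin d →-setoid ℤ) (proj₁ {B = λ z → P (Vector.map fromℤ z)})

record Partition : Set where
  field
    parts      : List ℕ
    decreasing : Linked ℕ._≥_ parts
    positive   : All (0 ℕ.<_) parts

open Partition public

-- Boxes of the Young diagram; rows and columns are numbered from 0.
Box : Partition → Set
Box p = Σ (Fin (length (parts p))) λ i → Fin (lookup (parts p) i)

arm : (p : Partition) → Box p → ℕ
arm p (i , j) = lookup (parts p) i ∸ suc (toℕ j)

-- The boxes below (i , j) lie in the later rows having more than j boxes.
leg : (p : Partition) → Box p → ℕ
leg p (i , j) = length (filter (toℕ j ℕ.<?_) (drop (suc (toℕ i)) (parts p)))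

hookLength : (p : Partition) → Box p → ℕ
hookLength p u = suc (arm p u ℕ.+ leg p u)

IsCore : ℕ → Partition → Set
IsCore a p = ∀ (u : Box p) → ¬ (a ∣ hookLength p u)

IsMultiCore : ∀ {m} → ℕ → Vector ℕ m → Partition → Set
IsMultiCore a b p = IsCore a p × (∀ j → IsCore (b j) p)

-- Two cores are equal when they have the same parts; the proofs of the
-- core conditions are disregarded.
cores : ∀ {m} → ℕ → Vector ℕ m → Setoid 0ℓ 0ℓ
cores a b = On.setoid (setoid (List ℕ)) λ (c : Σ Partition (IsMultiCore a b)) → parts (proj₁ c)

gcdAll : ∀ {m} → ℕ → Vector ℕ m → ℕ
gcdAll a b = Vector.foldr gcd a b

-- The coordinate x_n, for 1 ≤ n ≤ a - 1, is x i for the i with index i ≡ n.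
-- In CorePolytope below, a coordinate at a computed subscript n is therefore
-- written x i′ together with the hypothesis index i′ ≡ n.
index : ∀ {d} → Fin d → ℕ
index i = suc (toℕ i)

record CorePolytope {m} (a : ℕ) (k ℓ : Vector ℕ m) (x : Vector ℝ (a ∸ 1)) : Set where
  field
    start : ∀ j i → index i ≡ ℓ j → x i ≤ fromℕ (k j)
    step  : ∀ j i → index i ℕ.+ ℓ j ℕ.< a →
            ∀ i′ → index i′ ≡ index i ℕ.+ ℓ j →
            x i′ ≤ fromℕ (k j) + x i
    wrap  : ∀ j i → a ℕ.< index i ℕ.+ ℓ j →
            ∀ i′ → index i′ ≡ index i ℕ.+ ℓ j ∸ a →
            x i′ ≤ fromℕ (k j) + x i + 1ℝ
    0≤    : ∀ i → 0ℝ ≤ x i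

{-# OPTIONS --safe #-}
-- Let X be the set of hook lengths in the first column of a partition.  The
-- hook lengths of the whole diagram are the differences h - v with h ∈ X,
-- v ∉ X and 0 ≤ v < h, so the partition is an a-core exactly when X is closed
-- under subtraction of a (as far as the result is not negative).  Then X is
-- determined by the numbers y_r of its elements congruent to r modulo a, with
-- y_0 = 0, and closure under subtraction of b_j = a k_j + ℓ_j says
-- y_s ≤ k_j + y_r + e whenever r + ℓ_j = s + e a with 0 ≤ r, s < a.
-- For boundedness, the same inequalities carry an upper bound for x_r to one for
-- x_{r + b_j} (indices modulo a), and as gcd(a, b_1, …, b_m) = 1 these steps
-- lead from x_0 = 0 to every coordinate.
module Submission where

open import Defs hiding (_≤_; _+_; _*_)
import Defs as ℝ
open import Data.Nat.Base using (ℕ; _≤_; _<_; _+_; _*_)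
open import Data.Nat.Base using (zero; suc; _≥_; _>_; _∸_; _⊔_; z≤n; s≤s; z<s; s<s⁻¹)
open import Data.Nat.Divisibility using (_∣_; divides; ∣-refl)
open import Data.Nat.DivMod using (_/_; _%_; _mod_; m≡m%n+[m/n]*n; m%n<n; [m+kn]%n≡m%n; m<n⇒m%n≡m)
open import Data.Nat.GCD using (gcd; gcd-GCD; module Bézout)
import Data.Nat.Properties as ℕ
import Data.Nat.Solver as ℕ
open import Data.Fin.Base as Fin using (Fin; zero; suc; toℕ)
import Data.Fin.Properties as Fin
open import Data.Integer.Base as ℤ using (ℤ; +_)
import Data.Integer.Properties as ℤ
open import Data.List.Base as List using (List; []; _∷_; length; filter; downFrom)
open import Data.List.Extrema.Nat using (xs≤max)
open import Data.List.Membership.DecPropositional ℕ._≟_ using (_∈?_)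
open import Data.List.Membership.Propositional using (_∈_; _∉_)
open import Data.List.Membership.Propositional.Properties using (∈-filter⁺; ∈-filter⁻; ∈-downFrom⁺)
import Data.List.Properties as List
open import Data.List.Relation.Unary.All as All using (All; []; _∷_)
open import Data.List.Relation.Unary.AllPairs using (AllPairs; []; _∷_)
import Data.List.Relation.Unary.AllPairs.Properties as AllPairs
open import Data.List.Relation.Unary.Any using (here; there)
open import Data.List.Relation.Unary.Linked using (Linked; []; [-]; _∷_)
open import Data.List.Relation.Unary.Linked.Properties using (Linked⇒AllPairs)
open import Data.Product.Base using (_×_)
open import Data.Product.Base using (Σ; ∃-syntax; _,_; proj₁; proj₂)
open import Data.Rational.Base as ℚ using (ℚ; 0ℚ; 1ℚ)
import Data.Rational.Properties as ℚ
import Data.Rational.Solver as ℚ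
import Data.Rational.Unnormalised.Base as ℚᵘ
import Data.Rational.Unnormalised.Properties as ℚᵘ
open import Data.Sum.Base using (inj₁; inj₂)
open import Data.Vec.Functional using (Vector)
import Data.Vec.Functional as Vector
import Data.Vec.Functional.Properties as Vector
open import Function.Base using (id; _∘_)
open import Function.Bundles using (Bijection)
open import Function.Bundles using (_⇔_; mk⇔; Equivalence)
open import Level using (0ℓ)
open import Relation.Binary.Definitions using (tri<; tri≈; tri>)
open import Relation.Binary.PropositionalEquality using (_≡_)
open import Relation.Binary.PropositionalEquality
  using (_≢_; refl; sym; trans; cong; cong₂; subst; subst₂; module ≡-Reasoning)
open import Relation.Nullary using (Dec; yes; no; contradiction; ¬_)
open import Relation.Nullary.Decidable using (decidable-stable)
open import Relation.Unary using (Decidable; Pred; _∩_)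

open CorePolytope
open ℚ.+-*-Solver using (solve; _:+_; _:*_; _:-_; :-_; _:=_)
open ℕ.+-*-Solver using () renaming
  (solve to ℕ-solve; con to ℕ-con; _:+_ to _⊕_; _:*_ to _⊗_; _:=_ to _≐_)

-- The order on the reals and its restriction to integers.

ℝ-≤-trans : ∀ {x y z} → x ℝ.≤ y → y ℝ.≤ z → x ℝ.≤ z
ℝ-≤-trans {x} {y} {z} x≤y y≤z ε 0<ε =
  -- The tolerance is split as `δ` plus `ε - δ`, one share for each hypothesis.
  let δ , 0<δ , δ<ε = ℚ.<-dense 0<ε
      M , p = x≤y δ 0<δ
      N , q = y≤z (ε ℚ.- δ) (subst (ℚ._< ε ℚ.- δ) (ℚ.+-inverseʳ δ) (ℚ.+-monoˡ-< (ℚ.- δ) δ<ε))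
  in M ⊔ N , λ n M⊔N≤n → begin
       seq x n                        ≤⟨ p n (ℕ.m⊔n≤o⇒m≤o M N M⊔N≤n) ⟩
       seq y n ℚ.+ δ                  ≤⟨ ℚ.+-monoˡ-≤ δ (q n (ℕ.m⊔n≤o⇒n≤o M N M⊔N≤n)) ⟩
       seq z n ℚ.+ (ε ℚ.- δ) ℚ.+ δ
         ≡⟨ solve 3 (λ z ε δ → z :+ (ε :- δ) :+ δ := z :+ ε) refl (seq z n) ε δ ⟩
       seq z n ℚ.+ ε                  ∎
  where open ℚ.≤-Reasoning

ℝ-≤-pointwise : ∀ {x y} → (∀ n → seq x n ℚ.≤ seq y n) → x ℝ.≤ y
ℝ-≤-pointwise {x} {y} x≤y ε 0<ε = 0 , λ n _ →
  ℚ.≤-trans (x≤y n) (subst (ℚ._≤ seq y n ℚ.+ ε) (ℚ.+-identityʳ (seq y n))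
                           (ℚ.+-monoʳ-≤ (seq y n) (ℚ.<⇒≤ 0<ε)))

-- Turns the moving of terms across an inequality into a ring identity between rationals.
ℝ-≤-resp-difference : ∀ {x y x′ y′} →
  (∀ n → seq y n ℚ.- seq x n ≡ seq y′ n ℚ.- seq x′ n) → x ℝ.≤ y → x′ ℝ.≤ y′
ℝ-≤-resp-difference {x} {y} {x′} {y′} y-x≡y′-x′ x≤y ε 0<ε =
  let N , p = x≤y ε 0<ε in N , λ n N≤n → begin
    seq x′ n
      ≡⟨ solve 2 (λ x x′ → x′ := x :+ (x′ :- x)) refl (seq x n) (seq x′ n) ⟩
    seq x n ℚ.+ (seq x′ n ℚ.- seq x n)
      ≤⟨ ℚ.+-monoˡ-≤ _ (p n N≤n) ⟩
    seq y n ℚ.+ ε ℚ.+ (seq x′ n ℚ.- seq x n)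
      ≡⟨ solve 4 (λ x y x′ ε → y :+ ε :+ (x′ :- x) := (y :- x) :+ x′ :+ ε) refl
           (seq x n) (seq y n) (seq x′ n) ε ⟩
    (seq y n ℚ.- seq x n) ℚ.+ seq x′ n ℚ.+ ε
      ≡⟨ cong (λ q → q ℚ.+ seq x′ n ℚ.+ ε) (y-x≡y′-x′ n) ⟩
    (seq y′ n ℚ.- seq x′ n) ℚ.+ seq x′ n ℚ.+ ε
      ≡⟨ solve 3 (λ x′ y′ ε → (y′ :- x′) :+ x′ :+ ε := y′ :+ ε) refl (seq x′ n) (seq y′ n) ε ⟩
    seq y′ n ℚ.+ ε ∎
  where open ℚ.≤-Reasoning

-- If `q < p`, a rational `r` strictly between them yields the tolerance `r - q`, which `x ≤ y`
-- cannot meet. Constancy is a pointwise hypothesis because a sum of constants is not literally a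
-- `fromℚ`.
ℝ-≤-constant⁻¹ : ∀ {x y p q} → (∀ n → seq x n ≡ p) → (∀ n → seq y n ≡ q) →
  x ℝ.≤ y → p ℚ.≤ q
ℝ-≤-constant⁻¹ {x} {y} {p} {q} x≡p y≡q x≤y = ℚ.≮⇒≥ λ q<p →
  let r , q<r , r<p = ℚ.<-dense q<p
      N , h = x≤y (r ℚ.- q) (subst (ℚ._< r ℚ.- q) (ℚ.+-inverseʳ q) (ℚ.+-monoˡ-< (ℚ.- q) q<r))
  in ℚ.<-irrefl refl (ℚ.<-≤-trans r<p (subst₂ ℚ._≤_ (x≡p N)
       (trans (cong (ℚ._+ (r ℚ.- q)) (y≡q N))
              (solve 2 (λ q r → q :+ (r :- q) := r) refl q r))
       (h N ℕ.≤-refl)))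

-- Reduction to lowest terms blocks computation; among unnormalised fractions with denominator 1
-- only an integer identity remains.
/1-homo-+ : ∀ i j → (i ℤ.+ j) ℚ./ 1 ≡ i ℚ./ 1 ℚ.+ j ℚ./ 1
/1-homo-+ i j = ℚ.toℚᵘ-injective (begin
  ℚ.toℚᵘ ((i ℤ.+ j) ℚ./ 1)
    ≈⟨ ℚ.toℚᵘ-fromℚᵘ (ℚᵘ.mkℚᵘ (i ℤ.+ j) 0) ⟩
  ℚᵘ.mkℚᵘ (i ℤ.+ j) 0
    ≈⟨ ℚᵘ.*≡* (cong (ℤ._* + 1) (sym (cong₂ ℤ._+_ (ℤ.*-identityʳ i) (ℤ.*-identityʳ j)))) ⟩
  ℚᵘ.mkℚᵘ i 0 ℚᵘ.+ ℚᵘ.mkℚᵘ j 0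
    ≈⟨ ℚᵘ.+-cong (ℚ.toℚᵘ-fromℚᵘ (ℚᵘ.mkℚᵘ i 0)) (ℚ.toℚᵘ-fromℚᵘ (ℚᵘ.mkℚᵘ j 0)) ⟨
  ℚ.toℚᵘ (i ℚ./ 1) ℚᵘ.+ ℚ.toℚᵘ (j ℚ./ 1)
    ≈⟨ ℚ.toℚᵘ-homo-+ (i ℚ./ 1) (j ℚ./ 1) ⟨
  ℚ.toℚᵘ (i ℚ./ 1 ℚ.+ j ℚ./ 1) ∎)
  where open ℚᵘ.≃-Reasoning

/1-mono-≤ : ∀ {i j} → i ℤ.≤ j → i ℚ./ 1 ℚ.≤ j ℚ./ 1
/1-mono-≤ {i} {j} i≤j = ℚ.toℚᵘ-cancel-≤ (begin
  ℚ.toℚᵘ (i ℚ./ 1)   ≃⟨ ℚ.toℚᵘ-fromℚᵘ (ℚᵘ.mkℚᵘ i 0) ⟩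
  ℚᵘ.mkℚᵘ i 0        ≤⟨ ℚᵘ.*≤* (ℤ.*-monoʳ-≤-nonNeg (+ 1) i≤j) ⟩
  ℚᵘ.mkℚᵘ j 0        ≃⟨ ℚ.toℚᵘ-fromℚᵘ (ℚᵘ.mkℚᵘ j 0) ⟨
  ℚ.toℚᵘ (j ℚ./ 1)   ∎)
  where open ℚᵘ.≤-Reasoning

/1-cancel-≤ : ∀ {i j} → i ℚ./ 1 ℚ.≤ j ℚ./ 1 → i ℤ.≤ j
/1-cancel-≤ {i} {j} i≤j = unwrap (begin
  ℚᵘ.mkℚᵘ i 0        ≃⟨ ℚ.toℚᵘ-fromℚᵘ (ℚᵘ.mkℚᵘ i 0) ⟨
  ℚ.toℚᵘ (i ℚ./ 1)   ≤⟨ ℚ.toℚᵘ-mono-≤ i≤j ⟩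
  ℚ.toℚᵘ (j ℚ./ 1)   ≃⟨ ℚ.toℚᵘ-fromℚᵘ (ℚᵘ.mkℚᵘ j 0) ⟩
  ℚᵘ.mkℚᵘ j 0        ∎)
  where
  open ℚᵘ.≤-Reasoning
  unwrap : ℚᵘ.mkℚᵘ i 0 ℚᵘ.≤ ℚᵘ.mkℚᵘ j 0 → i ℤ.≤ j
  unwrap (ℚᵘ.*≤* p) = ℤ.*-cancelʳ-≤-pos i j (+ 1) p

fromℕ-+ : ∀ m n o → (+ (m + n + o)) ℚ./ 1 ≡ (+ m) ℚ./ 1 ℚ.+ (+ n) ℚ./ 1 ℚ.+ (+ o) ℚ./ 1
fromℕ-+ m n o = trans (/1-homo-+ (+ (m + n)) (+ o)) (cong (ℚ._+ (+ o) ℚ./ 1) (/1-homo-+ (+ m) (+ n)))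

fromℕ-≤-+⁻ : ∀ {x y m n} k e → (∀ i → seq x i ≡ (+ m) ℚ./ 1) → (∀ i → seq y i ≡ (+ n) ℚ./ 1) →
  x ℝ.≤ fromℕ k ℝ.+ y ℝ.+ fromℕ e → m ≤ k + n + e
fromℕ-≤-+⁻ {x} {y} {m} {n} k e x≡m y≡n x≤ = ℤ.drop‿+≤+ (/1-cancel-≤
  (ℝ-≤-constant⁻¹ {x} {fromℕ k ℝ.+ y ℝ.+ fromℕ e} x≡m
    (λ i → trans (cong (λ q → (+ k) ℚ./ 1 ℚ.+ q ℚ.+ (+ e) ℚ./ 1) (y≡n i)) (sym (fromℕ-+ k n e))) x≤))

fromℕ-≤-+⁺ : ∀ {m} k n e → m ≤ k + n + e → fromℕ m ℝ.≤ fromℕ k ℝ.+ fromℕ n ℝ.+ fromℕ e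
fromℕ-≤-+⁺ {m} k n e m≤ = ℝ-≤-pointwise {fromℕ m} {fromℕ k ℝ.+ fromℕ n ℝ.+ fromℕ e} λ _ →
  subst ((+ m) ℚ./ 1 ℚ.≤_) (fromℕ-+ k n e) (/1-mono-≤ (ℤ.+≤+ m≤))

-- Polyhedra and linear forms.

module _ {d : ℕ} where

  IsPolyhedron-resp : {P Q : Pred (Vector ℝ d) 0ℓ} → (∀ x → Q x ⇔ P x) → IsPolyhedron P →
    IsPolyhedron Q
  IsPolyhedron-resp Q⇔P (r , A , c , P⇔) = r , A , c , λ x →
    mk⇔ (λ q → Equivalence.to (P⇔ x) (Equivalence.to (Q⇔P x) q))
        (λ h → Equivalence.from (Q⇔P x) (Equivalence.from (P⇔ x) h))

  IsPolyhedron-universal : {P : Pred (Vector ℝ d) 0ℓ} → (∀ x → P x) → IsPolyhedron P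
  IsPolyhedron-universal p = 0 , (λ ()) , (λ ()) , λ x → mk⇔ (λ _ ()) (λ _ → p x)

  IsPolyhedron-∩ : {P Q : Pred (Vector ℝ d) 0ℓ} → IsPolyhedron P → IsPolyhedron Q →
    IsPolyhedron (P ∩ Q)
  IsPolyhedron-∩ (r , A , c , P⇔) (r′ , A′ , c′ , Q⇔) =
    r + r′ , A″ , c″ , λ x →
      mk⇔ (λ (p , q) → both x (Equivalence.to (P⇔ x) p) (Equivalence.to (Q⇔ x) q))
          (λ h → Equivalence.from (P⇔ x)
                   (λ s → subst₂ (λ u v → u ∙ x ℝ.≤ v)
                     (Vector.lookup-++ˡ A A′ s) (Vector.lookup-++ˡ c c′ s) (h (s Fin.↑ˡ r′)))
               , Equivalence.from (Q⇔ x)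
                   (λ s → subst₂ (λ u v → u ∙ x ℝ.≤ v)
                     (Vector.lookup-++ʳ A A′ s) (Vector.lookup-++ʳ c c′ s) (h (r Fin.↑ʳ s))))
    where
    A″ = A Vector.++ A′
    c″ = c Vector.++ c′
    both : ∀ x → (∀ s → A s ∙ x ℝ.≤ c s) → (∀ s → A′ s ∙ x ℝ.≤ c′ s) → ∀ s → A″ s ∙ x ℝ.≤ c″ s
    both x p q s with Fin.splitAt r s
    ... | inj₁ s₁ = p s₁
    ... | inj₂ s₂ = q s₂

  IsPolyhedron-∀ : ∀ {n} {P : Fin n → Pred (Vector ℝ d) 0ℓ} →
    (∀ i → IsPolyhedron (P i)) → IsPolyhedron (λ x → ∀ i → P i x)
  IsPolyhedron-∀ {zero}  _  = IsPolyhedron-universal λ _ ()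
  IsPolyhedron-∀ {suc n} ps = IsPolyhedron-resp
    (λ x → mk⇔ (λ p → p zero , λ i → p (suc i)) (λ (p , q) → λ { zero → p ; (suc i) → q i }))
    (IsPolyhedron-∩ (ps zero) (IsPolyhedron-∀ (ps ∘ suc)))

  -- `C` does not involve `x`: once decided, it leaves either the constraint itself or no
  -- constraint.
  IsPolyhedron-⇒ : {C : Set} {P : Pred (Vector ℝ d) 0ℓ} →
    Dec C → IsPolyhedron P → IsPolyhedron (λ x → C → P x)
  IsPolyhedron-⇒ (yes c) P = IsPolyhedron-resp (λ x → mk⇔ (λ f → f c) (λ p _ → p)) P
  IsPolyhedron-⇒ (no ¬c) _ = IsPolyhedron-universal λ _ c → contradiction c ¬c

-- Agreement is demanded term by term, which is more than equality of reals. The operations are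
-- pointwise, so this is attainable, and it keeps all later identities inside `ℚ`.
record Linear {d} (f : Vector ℝ d → ℝ) : Set where
  constructor _,_
  field
    coefficients : Vector ℝ d
    represents   : ∀ x n → seq (coefficients ∙ x) n ≡ seq (f x) n

-- The inequality `g x ≤ h x` and the half-space `A ∙ x ≤ c` have the same difference of sides, so
-- each gives the other.
halfspace : ∀ {d} {f : Vector ℝ d → ℝ} {c} → Linear f → (g h : Vector ℝ d → ℝ) →
  (∀ x n → seq (h x) n ℚ.- seq (g x) n ≡ seq c n ℚ.- seq (f x) n) →
  IsPolyhedron (λ x → g x ℝ.≤ h x)
halfspace {c = c} (A , A≡f) g h eq = 1 , (λ _ → A) , (λ _ → c) , λ x →
  mk⇔ (λ p _ → ℝ-≤-resp-difference {g x} {h x} {A ∙ x} {c} (eq′ x) p)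
      (λ p → ℝ-≤-resp-difference {A ∙ x} {c} {g x} {h x} (λ n → sym (eq′ x n)) (p zero))
  where
  eq′ : ∀ x n → seq (h x) n ℚ.- seq (g x) n ≡ seq c n ℚ.- seq (A ∙ x) n
  eq′ x n = trans (eq x n) (cong (λ q → seq c n ℚ.- q) (sym (A≡f x n)))

linear-0 : ∀ {d} → Linear {d} (λ _ → 0ℝ)
linear-0 = (λ _ → 0ℝ) , eq
  where
  eq : ∀ {d} (x : Vector ℝ d) n → seq ((λ _ → 0ℝ) ∙ x) n ≡ 0ℚ
  eq {zero}  x n = refl
  eq {suc d} x n = trans (cong₂ ℚ._+_ (ℚ.*-zeroˡ (seq (x zero) n)) (eq (Vector.tail x) n)) (ℚ.+-identityˡ 0ℚ)

linear-coordinate : ∀ {d} (i : Fin d) → Linear (λ x → x i)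
linear-coordinate {suc d} zero with linear-0 {d}
... | A , A≡0 = (1ℝ Vector.∷ A) , λ x n →
  trans (cong₂ ℚ._+_ (ℚ.*-identityˡ (seq (x zero) n)) (A≡0 (Vector.tail x) n)) (ℚ.+-identityʳ _)
linear-coordinate {suc d} (suc i) with linear-coordinate i
... | A , A≡xᵢ = (0ℝ Vector.∷ A) , λ x n →
  trans (cong₂ ℚ._+_ (ℚ.*-zeroˡ (seq (x zero) n)) (A≡xᵢ (Vector.tail x) n)) (ℚ.+-identityˡ _)

linear-difference : ∀ {d} {f g : Vector ℝ d → ℝ} → Linear f → Linear g → Linear (λ x → f x ℝ.+ - g x)
linear-difference (A , A≡f) (B , B≡g) = (λ i → A i ℝ.+ - B i) , λ x n →
  trans (eq A B x n) (cong₂ ℚ._-_ (A≡f x n) (B≡g x n))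
  where
  eq : ∀ {d} (A B x : Vector ℝ d) n →
       seq ((λ i → A i ℝ.+ - B i) ∙ x) n ≡ seq (A ∙ x) n ℚ.- seq (B ∙ x) n
  eq {zero}  A B x n = refl
  eq {suc d} A B x n = trans
    (cong ((seq (A zero) n ℚ.+ ℚ.- seq (B zero) n) ℚ.* seq (x zero) n ℚ.+_)
          (eq (Vector.tail A) (Vector.tail B) (Vector.tail x) n))
    (solve 5 (λ a b x p q → (a :+ :- b) :* x :+ (p :- q) := (a :* x :+ p) :- (b :* x :+ q)) refl
       (seq (A zero) n) (seq (B zero) n) (seq (x zero) n)
       (seq (Vector.tail A ∙ Vector.tail x) n) (seq (Vector.tail B ∙ Vector.tail x) n))

isPolyhedron : ∀ {m} a (k ℓ : Vector ℕ m) → IsPolyhedron (CorePolytope a k ℓ)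
isPolyhedron a k ℓ = IsPolyhedron-resp
  (λ x → mk⇔ (λ p → start p , step p , wrap p , 0≤ p)
             (λ (p , q , r , s) → record { start = p ; step = q ; wrap = r ; 0≤ = s }))
  (IsPolyhedron-∩
    (IsPolyhedron-∀ λ j → IsPolyhedron-∀ λ i → IsPolyhedron-⇒ (_ ℕ.≟ _)
      (halfspace {c = fromℕ (k j)} (linear-coordinate i) (λ x → x i) (λ _ → fromℕ (k j))
        λ _ _ → refl))
  (IsPolyhedron-∩
    (IsPolyhedron-∀ λ j → IsPolyhedron-∀ λ i → IsPolyhedron-⇒ (_ ℕ.<? _)
      (IsPolyhedron-∀ λ i′ → IsPolyhedron-⇒ (_ ℕ.≟ _)
        (halfspace {c = fromℕ (k j)} (linear-difference (linear-coordinate i′) (linear-coordinate i))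
          (λ x → x i′) (λ x → fromℕ (k j) ℝ.+ x i)
          λ x n → solve 3 (λ k x y → k :+ x :- y := k :- (y :- x)) refl
            ((+ k j) ℚ./ 1) (seq (x i) n) (seq (x i′) n))))
  (IsPolyhedron-∩
    (IsPolyhedron-∀ λ j → IsPolyhedron-∀ λ i → IsPolyhedron-⇒ (_ ℕ.<? _)
      (IsPolyhedron-∀ λ i′ → IsPolyhedron-⇒ (_ ℕ.≟ _)
        (halfspace {c = fromℕ (k j) ℝ.+ 1ℝ} (linear-difference (linear-coordinate i′) (linear-coordinate i))
          (λ x → x i′) (λ x → fromℕ (k j) ℝ.+ x i ℝ.+ 1ℝ)
          λ x n → solve 4 (λ k x y o → k :+ x :+ o :- y := (k :+ o) :- (y :- x)) refl
            ((+ k j) ℚ./ 1) (seq (x i) n) (seq (x i′) n) 1ℚ)))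
    (IsPolyhedron-∀ λ i →
      -- The constraint is read as `0 - x i ≤ 0 - 0`; then the required identity involves only the
      -- ring variables `z`, standing for 0, and `x`.
      halfspace {c = 0ℝ ℝ.+ - 0ℝ} (linear-difference linear-0 (linear-coordinate i))
        (λ _ → 0ℝ) (λ x → x i)
        λ x n → solve 2 (λ z x → x :- z := (z :- z) :- (z :- x)) refl 0ℚ (seq (x i) n)))))

-- Boundedness

ℝ-≤-+ : ∀ {x y} k e → x ℝ.≤ y → x ℝ.≤ fromℕ k ℝ.+ y ℝ.+ fromℕ e
ℝ-≤-+ {x} {y} k e x≤y = ℝ-≤-trans {x} {y} {fromℕ k ℝ.+ y ℝ.+ fromℕ e} x≤y
  (ℝ-≤-pointwise {y} {fromℕ k ℝ.+ y ℝ.+ fromℕ e} λ n → begin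
    seq y n                                            ≡⟨ ℚ.+-identityʳ (seq y n) ⟨
    seq y n ℚ.+ 0ℚ                                     ≡⟨ cong (ℚ._+ 0ℚ) (ℚ.+-identityˡ (seq y n)) ⟨
    0ℚ ℚ.+ seq y n ℚ.+ 0ℚ
      ≤⟨ ℚ.+-mono-≤ (ℚ.+-monoˡ-≤ (seq y n) (/1-mono-≤ {+ 0} {+ k} (ℤ.+≤+ z≤n)))
                    (/1-mono-≤ {+ 0} {+ e} (ℤ.+≤+ z≤n)) ⟩
    (+ k) ℚ./ 1 ℚ.+ seq y n ℚ.+ (+ e) ℚ./ 1             ∎)
  where open ℚ.≤-Reasoning

ℝ-≤-+-zero : ∀ {x y} → x ℝ.≤ y → x ℝ.≤ y ℝ.+ 0ℝ
ℝ-≤-+-zero {x} {y} = ℝ-≤-resp-difference {x} {y} {x} {y ℝ.+ 0ℝ}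
  λ n → cong (ℚ._- seq x n) (sym (ℚ.+-identityʳ (seq y n)))

ℝ-≤-+-zero⁻¹ : ∀ {x y} → x ℝ.≤ y ℝ.+ 0ℝ → x ℝ.≤ y
ℝ-≤-+-zero⁻¹ {x} {y} = ℝ-≤-resp-difference {x} {y ℝ.+ 0ℝ} {x} {y}
  λ n → cong (ℚ._- seq x n) (ℚ.+-identityʳ (seq y n))

ℝ-+-mono-≤ : ∀ {x y} k e → x ℝ.≤ y → fromℕ k ℝ.+ x ℝ.+ fromℕ e ℝ.≤ fromℕ k ℝ.+ y ℝ.+ fromℕ e
ℝ-+-mono-≤ {x} {y} k e =
  ℝ-≤-resp-difference {x} {y} {fromℕ k ℝ.+ x ℝ.+ fromℕ e} {fromℕ k ℝ.+ y ℝ.+ fromℕ e} λ n →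
    solve 4 (λ k x y e → y :- x := (k :+ y :+ e) :- (k :+ x :+ e)) refl
      ((+ k) ℚ./ 1) (seq x n) (seq y n) ((+ e) ℚ./ 1)

-- Residues, and the inequalities with the coordinate 0 included.

toℕ-mod+/* : ∀ n d → n ≡ toℕ (n mod suc d) + (n / suc d) * suc d
toℕ-mod+/* n d = trans (m≡m%n+[m/n]*n n (suc d))
  (cong (_+ (n / suc d) * suc d) (sym (Fin.toℕ-fromℕ< (m%n<n n (suc d)))))

mod-unique : ∀ {d} (r : Fin (suc d)) t → (toℕ r + t * suc d) mod suc d ≡ r
mod-unique {d} r t = Fin.toℕ-injective (begin
  toℕ ((toℕ r + t * suc d) mod suc d)   ≡⟨ Fin.toℕ-fromℕ< _ ⟩
  (toℕ r + t * suc d) % suc d           ≡⟨ [m+kn]%n≡m%n (toℕ r) t (suc d) ⟩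
  toℕ r % suc d                         ≡⟨ m<n⇒m%n≡m (Fin.toℕ<n r) ⟩
  toℕ r                                 ∎)
  where open ≡-Reasoning

div-unique : ∀ {d} (r : Fin (suc d)) t → (toℕ r + t * suc d) / suc d ≡ t
div-unique {d} r t = ℕ.*-cancelʳ-≡ _ t (suc d) (ℕ.+-cancelˡ-≡ (toℕ r) _ _ (sym (begin
  toℕ r + t * suc d                        ≡⟨ toℕ-mod+/* n d ⟩
  toℕ (n mod suc d) + n / suc d * suc d    ≡⟨ cong (λ s → toℕ s + n / suc d * suc d) (mod-unique r t) ⟩
  toℕ r + n / suc d * suc d                ∎)))
  where
  open ≡-Reasoning
  n = toℕ r + t * suc d

-- The arithmetic behind every inequality: translation by b_j sends residue `r` to residue `s` and
-- raises the quotient by `k` plus the carry `e`. It serves both the bounds and the closure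
-- conditions.
shift-residue : ∀ {d} (r s : Fin (suc d)) {k l e} t → toℕ r + l ≡ toℕ s + e * suc d →
  (toℕ r + t * suc d) + (suc d * k + l) ≡ toℕ s + (k + t + e) * suc d
shift-residue {d} r s {k} {l} {e} t eq = begin
  (toℕ r + t * suc d) + (suc d * k + l)
    ≡⟨ ℕ-solve 5 (λ r t a k l → (r ⊕ t ⊗ a) ⊕ (a ⊗ k ⊕ l) ≐ (r ⊕ l) ⊕ (k ⊕ t) ⊗ a) refl
         (toℕ r) t (suc d) k l ⟩
  (toℕ r + l) + (k + t) * suc d
    ≡⟨ cong (_+ (k + t) * suc d) eq ⟩
  (toℕ s + e * suc d) + (k + t) * suc d
    ≡⟨ ℕ-solve 4 (λ s e u a → (s ⊕ e ⊗ a) ⊕ u ⊗ a ≐ s ⊕ (u ⊕ e) ⊗ a) refl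
         (toℕ s) e (k + t) (suc d) ⟩
  toℕ s + (k + t + e) * suc d ∎
  where open ≡-Reasoning

-- The common shape of the inequalities of the polytope, for y = (0, x₁, …, x_{a-1}).
Inequalities : ∀ {m d} (k ℓ : Vector ℕ m) {A : Set} (_≼_ : A → A → Set) (bound : ℕ → A → ℕ → A) →
  Vector A (suc d) → Set
Inequalities {d = d} k ℓ _≼_ bound y = ∀ j (r s : Fin (suc d)) e →
  toℕ r + ℓ j ≡ toℕ s + e * suc d → y s ≼ bound (k j) (y r) e

ℝ-Inequalities : ∀ {m d} (k ℓ : Vector ℕ m) → Vector ℝ d → Set
ℝ-Inequalities k ℓ x = Inequalities k ℓ ℝ._≤_ (λ k y e → fromℕ k ℝ.+ y ℝ.+ fromℕ e) (0ℝ Vector.∷ x)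

ℕ-Inequalities : ∀ {m d} (k ℓ : Vector ℕ m) → Vector ℕ (suc d) → Set
ℕ-Inequalities k ℓ = Inequalities k ℓ _≤_ (λ k y e → k + y + e)

module _ {m d : ℕ} {k ℓ : Vector ℕ m} (ℓ<a : ∀ j → ℓ j < suc d) where

  CorePolytope⇒0≤ : ∀ {x} → CorePolytope (suc d) k ℓ x → ∀ r → 0ℝ ℝ.≤ (0ℝ Vector.∷ x) r
  CorePolytope⇒0≤ P zero    = ℝ-≤-pointwise {0ℝ} {0ℝ} λ _ → ℚ.≤-refl
  CorePolytope⇒0≤ P (suc i) = 0≤ P i

  -- For `s = 0` the left side is 0 and nonnegativity suffices. Otherwise the carry decides: `e = 0`
  -- is `start` or `step` according to whether `r = 0`, and `e = 1` with `r > 0` is `wrap`. Larger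
  -- carries are excluded by `ℓ j < a` and `r < a`.
  CorePolytope⇒Inequalities : ∀ {x} → CorePolytope (suc d) k ℓ x → ℝ-Inequalities k ℓ x
  CorePolytope⇒Inequalities {x} P j r zero e eq =
    ℝ-≤-+ {0ℝ} {(0ℝ Vector.∷ x) r} (k j) e (CorePolytope⇒0≤ P r)
  CorePolytope⇒Inequalities {x} P j zero (suc i′) zero eq =
    ℝ-≤-+-zero {x i′} {fromℕ (k j) ℝ.+ 0ℝ} (ℝ-≤-+-zero {x i′} {fromℕ (k j)}
      (start P j i′ (sym (trans eq (ℕ.+-identityʳ _)))))
  CorePolytope⇒Inequalities P j zero (suc i′) (suc e) eq =
    contradiction (subst (suc d ≤_) (sym eq)
      (ℕ.≤-trans (ℕ.m≤m+n (suc d) (e * suc d)) (ℕ.m≤n+m _ (suc (toℕ i′)))))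
      (ℕ.<⇒≱ (ℓ<a j))
  CorePolytope⇒Inequalities {x} P j (suc i) (suc i′) zero eq =
    ℝ-≤-+-zero {x i′} {fromℕ (k j) ℝ.+ x i}
      (step P j i (subst (_< suc d) (sym i+ℓ≡i′) (Fin.toℕ<n (suc i′))) i′ (sym i+ℓ≡i′))
    where
    i+ℓ≡i′ : index i + ℓ j ≡ index i′
    i+ℓ≡i′ = trans eq (ℕ.+-identityʳ _)
  CorePolytope⇒Inequalities P j (suc i) (suc i′) (suc zero) eq =
    wrap P j i (subst (suc d <_) (sym i+ℓ≡i′+a) (ℕ.m<n+m (suc d) (s≤s z≤n))) i′
      (sym (trans (cong (_∸ suc d) i+ℓ≡i′+a) (ℕ.m+n∸n≡m (index i′) (suc d))))
    where
    i+ℓ≡i′+a : index i + ℓ j ≡ index i′ + suc d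
    i+ℓ≡i′+a = trans eq (cong (_+_ (index i′)) (ℕ.+-identityʳ _))
  CorePolytope⇒Inequalities P j (suc i) (suc i′) (suc (suc e)) eq =
    contradiction (begin
      suc d + suc d                     ≤⟨ ℕ.+-monoʳ-≤ (suc d) (ℕ.m≤m+n (suc d) (e * suc d)) ⟩
      suc d + (suc d + e * suc d)       ≤⟨ ℕ.m≤n+m _ (suc (toℕ i′)) ⟩
      suc (toℕ i′) + suc (suc e) * suc d ≡⟨ eq ⟨
      suc (toℕ i) + ℓ j                 ∎)
      (ℕ.<⇒≱ (ℕ.+-mono-< (Fin.toℕ<n (suc i)) (ℓ<a j)))
    where open ℕ.≤-Reasoning

-- Periods of predicates on the natural numbers.

-- Both directions are required so that differences of periods, and hence greatest common divisors,
-- are again periods.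
Periodic : (ℕ → Set) → ℕ → Set
Periodic R d = (∀ r → R r → R (r + d)) × (∀ r → R (r + d) → R r)

module _ {R : ℕ → Set} where

  Periodic-* : ∀ {d} t → Periodic R d → Periodic R (t * d)
  Periodic-* zero _ = (λ r → subst R (sym (ℕ.+-identityʳ r))) , (λ r → subst R (ℕ.+-identityʳ r))
  Periodic-* {d} (suc t) (f , g) =
    let f′ , g′ = Periodic-* t (f , g) in
      (λ r p → subst R (ℕ.+-assoc r d (t * d)) (f′ (r + d) (f r p)))
    , (λ r p → g r (g′ (r + d) (subst R (sym (ℕ.+-assoc r d (t * d))) p)))

  -- A step of `d` is a step of `p` forward and one of `q` back; in this order no index becomes
  -- negative.
  Periodic-difference : ∀ {d p q} → d + q ≡ p → Periodic R p → Periodic R q → Periodic R d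
  Periodic-difference {d} {p} {q} d+q≡p (f , g) (f′ , g′) =
      (λ r x → g′ (r + d) (subst R (sym (eq r)) (f r x)))
    , (λ r x → g r (subst R (eq r) (f′ (r + d) x)))
    where
    eq : ∀ r → r + d + q ≡ r + p
    eq r = trans (ℕ.+-assoc r d q) (cong (_+_ r) d+q≡p)

  -- Bézout's identity makes the gcd a difference of a multiple of one period and a multiple of the
  -- other, in one of the two orders.
  Periodic-gcd : ∀ {m n} → Periodic R m → Periodic R n → Periodic R (gcd m n)
  Periodic-gcd {m} {n} pm pn with Bézout.identity (gcd-GCD m n)
  ... | Bézout.+- x y eq = Periodic-difference eq (Periodic-* x pm) (Periodic-* y pn)
  ... | Bézout.-+ x y eq = Periodic-difference eq (Periodic-* y pn) (Periodic-* x pm)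

  Periodic-gcdAll : ∀ {m a} {b : Vector ℕ m} →
    Periodic R a → (∀ j → Periodic R (b j)) → Periodic R (gcdAll a b)
  Periodic-gcdAll {zero}  pa pb = pa
  Periodic-gcdAll {suc m} pa pb = Periodic-gcd (pb zero) (Periodic-gcdAll pa (pb ∘ suc))

  -- Modulo a period a, translation by -b is translation by (a - 1) b.
  preserved⇒Periodic : ∀ {a b} → Periodic R (suc a) → (∀ r → R r → R (r + b)) → Periodic R b
  preserved⇒Periodic {a} {b} pa f = f , λ r p →
    proj₂ (Periodic-* b pa) r (subst R (trans (ℕ.+-assoc r b (a * b)) (cong (_+_ r) (ℕ.*-comm (suc a) b)))
      (iterate a (r + b) p))
    where
    iterate : ∀ t r → R r → R (r + t * b)
    iterate zero    r p = subst R (sym (ℕ.+-identityʳ r)) p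
    iterate (suc t) r p = subst R (ℕ.+-assoc r b (t * b)) (iterate t (r + b) (f r p))

-- Bounds for the coordinates.

module _ {m d : ℕ} {b k ℓ : Vector ℕ m} (gcd≡1 : gcdAll (suc d) b ≡ 1)
         (b≡ : ∀ j → b j ≡ suc d * k j + ℓ j) (ℓ<a : ∀ j → ℓ j < suc d) where

  -- Indices run through all of `ℕ` and are read modulo a, so that the results on periods apply. One
  -- rational has to serve all points of the polytope.
  BoundedAt : ℕ → Set
  BoundedAt r = ∃[ q ] (∀ x → CorePolytope (suc d) k ℓ x → (0ℝ Vector.∷ x) (r mod suc d) ℝ.≤ fromℚ q)

  -- The inequality leading from the residue of `r` to that of `r + b j` raises a bound `q` to k_j +
  -- q + e.
  BoundedAt-+b : ∀ j r → BoundedAt r → BoundedAt (r + b j)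
  BoundedAt-+b j r (q , y≤q) = (+ k j) ℚ./ 1 ℚ.+ q ℚ.+ (+ e) ℚ./ 1 , λ x P →
    subst (λ t → (0ℝ Vector.∷ x) t ℝ.≤ fromℚ ((+ k j) ℚ./ 1 ℚ.+ q ℚ.+ (+ e) ℚ./ 1)) s≡
      (ℝ-≤-trans {(0ℝ Vector.∷ x) s} {fromℕ (k j) ℝ.+ (0ℝ Vector.∷ x) r₀ ℝ.+ fromℕ e}
                 {fromℕ (k j) ℝ.+ fromℚ q ℝ.+ fromℕ e}
        (CorePolytope⇒Inequalities ℓ<a P j r₀ s e (toℕ-mod+/* (toℕ r₀ + ℓ j) d))
        (ℝ-+-mono-≤ {(0ℝ Vector.∷ x) r₀} {fromℚ q} (k j) e (y≤q x P)))
    where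
    r₀ = r mod suc d
    s  = (toℕ r₀ + ℓ j) mod suc d
    e  = (toℕ r₀ + ℓ j) / suc d
    t  = r / suc d
    s≡ : s ≡ (r + b j) mod suc d
    s≡ = sym (begin
      (r + b j) mod suc d
        ≡⟨ cong (_mod suc d) (cong₂ _+_ (toℕ-mod+/* r d) (b≡ j)) ⟩
      ((toℕ r₀ + t * suc d) + (suc d * k j + ℓ j)) mod suc d
        ≡⟨ cong (_mod suc d) (shift-residue r₀ s t (toℕ-mod+/* (toℕ r₀ + ℓ j) d)) ⟩
      (toℕ s + (k j + t + e) * suc d) mod suc d
        ≡⟨ mod-unique s (k j + t + e) ⟩
      s ∎)
      where open ≡-Reasoning

  BoundedAt-Periodic-a : Periodic BoundedAt (suc d)
  BoundedAt-Periodic-a =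
      (λ r (q , p) → q , λ x P → subst (λ t → (0ℝ Vector.∷ x) t ℝ.≤ fromℚ q) (sym (eq r)) (p x P))
    , (λ r (q , p) → q , λ x P → subst (λ t → (0ℝ Vector.∷ x) t ℝ.≤ fromℚ q) (eq r) (p x P))
    where
    open ≡-Reasoning
    eq : ∀ r → (r + suc d) mod suc d ≡ r mod suc d
    eq r = begin
      (r + suc d) mod suc d
        ≡⟨ cong (λ n → (n + suc d) mod suc d) (toℕ-mod+/* r d) ⟩
      (toℕ (r mod suc d) + (r / suc d) * suc d + suc d) mod suc d
        ≡⟨ cong (_mod suc d) (trans (ℕ.+-assoc (toℕ (r mod suc d)) _ (suc d))
             (cong (_+_ (toℕ (r mod suc d))) (ℕ.+-comm _ (suc d)))) ⟩
      (toℕ (r mod suc d) + suc (r / suc d) * suc d) mod suc d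
        ≡⟨ mod-unique (r mod suc d) (suc (r / suc d)) ⟩
      r mod suc d ∎

  -- As the gcd is 1, boundedness has period 1; it therefore spreads from index 0, where the
  -- coordinate is the constant 0, to every `r`.
  boundedAt : ∀ r → BoundedAt r
  boundedAt r = subst BoundedAt (ℕ.*-identityʳ r) (proj₁ (Periodic-* r periodic-1) 0
    (0ℚ , λ x P → ℝ-≤-pointwise {0ℝ} {0ℝ} λ _ → ℚ.≤-refl))
    where
    periodic-1 : Periodic BoundedAt 1
    periodic-1 = subst (Periodic BoundedAt) gcd≡1
      (Periodic-gcdAll BoundedAt-Periodic-a (λ j → preserved⇒Periodic BoundedAt-Periodic-a (BoundedAt-+b j)))

  -- `0ℚ ℚ.≤ q` is carried along so that `- q` is a lower bound as well, the coordinates being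
  -- nonnegative.
  commonBound : ∀ {n} (r : Vector ℕ n) → ∃[ q ] (0ℚ ℚ.≤ q ×
    (∀ x → CorePolytope (suc d) k ℓ x → ∀ i → (0ℝ Vector.∷ x) (r i mod suc d) ℝ.≤ fromℚ q))
  commonBound {zero}  r = 0ℚ , ℚ.≤-refl , λ _ _ ()
  commonBound {suc n} r with boundedAt (r zero) | commonBound (r ∘ suc)
  ... | q₀ , p₀ | q , 0≤q , p = q₀ ℚ.⊔ q , ℚ.≤-trans 0≤q (ℚ.p≤q⊔p q₀ q) , λ where
    x P zero    → ℝ-≤-trans {(0ℝ Vector.∷ x) (r zero mod suc d)} {fromℚ q₀} {fromℚ (q₀ ℚ.⊔ q)}
      (p₀ x P) (ℝ-≤-pointwise {fromℚ q₀} {fromℚ (q₀ ℚ.⊔ q)} λ _ → ℚ.p≤p⊔q q₀ q)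
    x P (suc i) → ℝ-≤-trans {(0ℝ Vector.∷ x) (r (suc i) mod suc d)} {fromℚ q} {fromℚ (q₀ ℚ.⊔ q)}
      (p x P i) (ℝ-≤-pointwise {fromℚ q} {fromℚ (q₀ ℚ.⊔ q)} λ _ → ℚ.p≤q⊔p q₀ q)

  isBounded : IsBounded (CorePolytope (suc d) k ℓ)
  isBounded with commonBound (λ (i : Fin (suc d)) → toℕ i)
  ... | q , 0≤q , y≤q = fromℚ q , λ x P i →
      ℝ-≤-trans { - fromℚ q} {0ℝ} {x i}
        (ℝ-≤-pointwise { - fromℚ q} {0ℝ} λ _ → ℚ.neg-antimono-≤ 0≤q) (0≤ P i)
    , subst (λ r → (0ℝ Vector.∷ x) r ℝ.≤ fromℚ q)
        (trans (cong (_mod suc d) (sym (ℕ.+-identityʳ (index i)))) (mod-unique (suc i) 0))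
        (y≤q x P (suc i))

-- Partitions and their first columns

-- When the parts are positive, the first box of a row `p` above rows `ps` has `p - 1` boxes to its
-- right and `length ps` below it, so these are the first-column hook lengths.
firstColumn : List ℕ → List ℕ
firstColumn []       = []
firstColumn (p ∷ ps) = p + length ps ∷ firstColumn ps

-- The increasing enumeration of the complement of firstColumn ps (see gap-surjective).
gap : List ℕ → ℕ → ℕ
gap ps j = j + length (filter (ℕ._≤? j) ps)

length-filter-< : ∀ j ps → length (filter (j ℕ.<?_) ps) + length (filter (ℕ._≤? j) ps) ≡ length ps
length-filter-< j []       = refl
length-filter-< j (p ∷ ps) with j ℕ.<? p
... | yes j<p rewrite List.filter-accept (j ℕ.<?_) {xs = ps} j<p
                    | List.filter-reject (ℕ._≤? j) {xs = ps} (ℕ.<⇒≱ j<p) = cong suc (length-filter-< j ps)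
... | no  j≮p rewrite List.filter-reject (j ℕ.<?_) {xs = ps} j≮p
                    | List.filter-accept (ℕ._≤? j) {xs = ps} (ℕ.≮⇒≥ j≮p) =
  trans (ℕ.+-suc _ _) (cong suc (length-filter-< j ps))

gap-≤ : ∀ {j p ps} → p ≤ j → gap (p ∷ ps) j ≡ suc (gap ps j)
gap-≤ {j} {ps = ps} p≤j rewrite List.filter-accept (ℕ._≤? j) {xs = ps} p≤j = ℕ.+-suc j _

gap-> : ∀ {j p ps} → j < p → gap (p ∷ ps) j ≡ gap ps j
gap-> {j} {ps = ps} j<p rewrite List.filter-reject (ℕ._≤? j) {xs = ps} (ℕ.<⇒≱ j<p) = refl

gap-upper : ∀ ps j → gap ps j ≤ j + length ps
gap-upper ps j = ℕ.+-monoʳ-≤ j (List.length-filter (ℕ._≤? j) ps)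

gap-all : ∀ {ps j} → All (_≤ j) ps → gap ps j ≡ j + length ps
gap-all {ps} {j} ps≤j = cong (λ qs → j + length qs) (List.filter-all (ℕ._≤? j) ps≤j)

firstColumn-< : ∀ {n ps} → All (_≤ n) ps → All (_< n + length ps) (firstColumn ps)
firstColumn-< []           = []
firstColumn-< {n} {p ∷ ps} (p≤n ∷ ps≤n) =
  subst (p + length ps <_) (sym (ℕ.+-suc n (length ps))) (s≤s (ℕ.+-monoˡ-≤ (length ps) p≤n)) ∷
  All.map (λ v< → ℕ.<-≤-trans v< (ℕ.+-monoʳ-≤ n (ℕ.n≤1+n (length ps)))) (firstColumn-< ps≤n)

-- If `j < p`, the gap stays below the head `p + length ps`, and the tail is handled by induction.
-- If `p ≤ j`, every part is at most `j`, so the gap `j + length (p ∷ ps)` exceeds all entries.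
gap-∉ : ∀ {ps} j → AllPairs _≥_ ps → gap ps j ∉ firstColumn ps
gap-∉ j [] ()
gap-∉ {p ∷ ps} j (p≥ps ∷ dec) with j ℕ.<? p
... | yes j<p rewrite gap-> {ps = ps} j<p = λ where
  (here eq)  → ℕ.<⇒≢ (ℕ.≤-<-trans (gap-upper ps j) (ℕ.+-monoˡ-< (length ps) j<p)) eq
  (there v∈) → gap-∉ j dec v∈
... | no j≮p = λ v∈ → ℕ.<-irrefl (gap-all p∷ps≤j) (All.lookup (firstColumn-< p∷ps≤j) v∈)
  where
  p≤j = ℕ.≮⇒≥ j≮p
  p∷ps≤j = p≤j ∷ All.map (λ q≤p → ℕ.≤-trans q≤p p≤j) p≥ps

-- A new largest part `p` keeps the gaps with index below `p`, turns the gap with index `p` into the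
-- new entry `p + length ps`, and lowers each later index by one.
gap-surjective : ∀ {ps v} → AllPairs _≥_ ps → v ∉ firstColumn ps → ∃[ j ] gap ps j ≡ v
gap-surjective {[]} {v} [] _ = v , ℕ.+-identityʳ v
gap-surjective {p ∷ ps} {v} (p≥ps ∷ dec) v∉ with gap-surjective dec (v∉ ∘ there)
... | j , refl with ℕ.<-cmp j p
...   | tri< j<p _ _ = j , gap-> {ps = ps} j<p
...   | tri≈ _ refl _ = contradiction (here (gap-all p≥ps)) v∉
gap-surjective {p ∷ ps} (p≥ps ∷ dec) v∉ | suc j , refl | tri> _ _ (s≤s p≤j) = j , (begin
  gap (p ∷ ps) j       ≡⟨ gap-≤ {ps = ps} p≤j ⟩
  suc (gap ps j)       ≡⟨ cong suc (gap-all (All.map (λ q≤p → ℕ.≤-trans q≤p p≤j) p≥ps)) ⟩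
  suc j + length ps    ≡⟨ gap-all (All.map (λ q≤p → ℕ.≤-trans q≤p (ℕ.m≤n⇒m≤1+n p≤j)) p≥ps) ⟨
  gap ps (suc j)       ∎)
  where open ≡-Reasoning

-- Hook lengths as differences.

-- `hookLength` on bare lists, to which it unfolds, so that induction on the list is possible.
hook : ∀ ps (i : Fin (length ps)) → Fin (List.lookup ps i) → ℕ
hook ps i j = suc (List.lookup ps i ∸ suc (toℕ j)
  + length (filter (toℕ j ℕ.<?_) (List.drop (suc (toℕ i)) ps)))

-- The leg counts the lower rows longer than `j`, the gap counts the others, and together they are
-- `length ps`; the arm, the box itself and `j` add up to `p`.
gap+hook : ∀ p ps (j : Fin p) → gap ps (toℕ j) + hook (p ∷ ps) zero j ≡ p + length ps
gap+hook p ps j = begin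
  gap ps i + hook (p ∷ ps) zero j
    ≡⟨ ℕ-solve 4 (λ i l k r → (i ⊕ l) ⊕ (ℕ-con 1 ⊕ (k ⊕ r)) ≐ (k ⊕ (ℕ-con 1 ⊕ i)) ⊕ (r ⊕ l)) refl
         i (length (filter (ℕ._≤? i) ps)) (p ∸ suc i) (length (filter (i ℕ.<?_) ps)) ⟩
  (p ∸ suc i + suc i) + (length (filter (i ℕ.<?_) ps) + length (filter (ℕ._≤? i) ps))
    ≡⟨ cong₂ _+_ (ℕ.m∸n+n≡m (Fin.toℕ<n j)) (length-filter-< i ps) ⟩
  p + length ps ∎
  where
  open ≡-Reasoning
  i = toℕ j

-- For a box in the top row the witness is the gap indexed by its column. For a lower row the
-- witness of the tail persists: it cannot be the head, since adding the hook length to it gives an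
-- entry smaller than the head.
hook⇒∉+∈ : ∀ {ps} → AllPairs _≥_ ps → ∀ i j →
  ∃[ v ] (v ∉ firstColumn ps × v + hook ps i j ∈ firstColumn ps)
hook⇒∉+∈ {p ∷ ps} (p≥ps ∷ dec) zero j = gap ps (toℕ j)
  , (λ where
      (here eq)  → ℕ.<⇒≢ (ℕ.≤-<-trans (gap-upper ps (toℕ j)) (ℕ.+-monoˡ-< (length ps) (Fin.toℕ<n j))) eq
      (there v∈) → gap-∉ (toℕ j) dec v∈)
  , here (gap+hook p ps j)
hook⇒∉+∈ {p ∷ ps} (p≥ps ∷ dec) (suc i) j with hook⇒∉+∈ dec i j
... | v , v∉ , v+h∈ = v , (λ where
      (here refl) → ℕ.<⇒≱ (All.lookup (firstColumn-< p≥ps) v+h∈) (ℕ.m≤m+n _ _)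
      (there v∈)  → v∉ v∈)
  , there v+h∈

-- The entry `v + d` selects the row, and the index `j` of `v` as a gap selects the column.
∉+∈⇒hook : ∀ {ps v d} → AllPairs _≥_ ps → v ∉ firstColumn ps → v + d ∈ firstColumn ps →
  ∃[ i ] ∃[ j ] hook ps i j ≡ d
∉+∈⇒hook {p ∷ ps} {v} {d} (p≥ps ∷ dec) v∉ (there v+d∈) =
  let i , j , eq = ∉+∈⇒hook dec (v∉ ∘ there) v+d∈ in suc i , j , eq
∉+∈⇒hook {p ∷ ps} {v} {d} (p≥ps ∷ dec) v∉ (here v+d≡) with gap-surjective dec (v∉ ∘ there)
... | j , gap≡v with j ℕ.<? p
...   | yes j<p = zero , Fin.fromℕ< j<p , ℕ.+-cancelˡ-≡ v _ _ (begin
          v + hook (p ∷ ps) zero (Fin.fromℕ< j<p)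
            ≡⟨ cong (_+ hook (p ∷ ps) zero (Fin.fromℕ< j<p))
                 (trans (sym gap≡v) (cong (gap ps) (sym (Fin.toℕ-fromℕ< j<p)))) ⟩
          gap ps (toℕ (Fin.fromℕ< j<p)) + hook (p ∷ ps) zero (Fin.fromℕ< j<p)
            ≡⟨ gap+hook p ps (Fin.fromℕ< j<p) ⟩
          p + length ps
            ≡⟨ v+d≡ ⟨
          v + d ∎)
  where open ≡-Reasoning
-- A column index beyond the row would force `v` up to `p + length ps`, hence to be that entry.
...   | no j≮p = contradiction (here (ℕ.≤-antisym v≤ ≤v)) v∉
  where
  v≤ : v ≤ p + length ps
  v≤ = subst (v ≤_) v+d≡ (ℕ.m≤m+n v d)
  ≤v : p + length ps ≤ v
  ≤v = subst (p + length ps ≤_)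
    (trans (sym (gap-all (All.map (λ q≤p → ℕ.≤-trans q≤p (ℕ.≮⇒≥ j≮p)) p≥ps))) gap≡v)
    (ℕ.+-monoˡ-≤ (length ps) (ℕ.≮⇒≥ j≮p))

-- Cores as sets closed under subtraction.

ClosedUnder : ℕ → (ℕ → Set) → Set
ClosedUnder a X = ∀ v → X (v + a) → X v

sorted : ∀ p → AllPairs _≥_ (parts p)
sorted p = Linked⇒AllPairs (λ x≥y y≥z → ℕ.≤-trans y≥z x≥y) (decreasing p)

-- Were `v` missing while `v + a` is present, a itself would be a hook length. Membership is
-- decidable, so a proof by contradiction is legitimate.
isCore⇒closed : ∀ {a} p → IsCore a p → ClosedUnder a (_∈ firstColumn (parts p))
isCore⇒closed {a} p core v v+a∈ = decidable-stable (v ∈? firstColumn (parts p)) λ v∉ →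
  let i , j , eq = ∉+∈⇒hook (sorted p) v∉ v+a∈
  in core (i , j) (subst (a ∣_) (sym eq) ∣-refl)

-- A hook length `t * a` would give some `v` outside the set with `v + t * a` inside; subtracting a
-- `t` times reaches `v`.
closed⇒isCore : ∀ {a} p → ClosedUnder a (_∈ firstColumn (parts p)) → IsCore a p
closed⇒isCore {a} p closed (i , j) (divides t eq) with hook⇒∉+∈ (sorted p) i j
... | v , v∉ , v+h∈ = v∉ (descend t (subst (λ h → v + h ∈ firstColumn (parts p)) eq v+h∈))
  where
  descend : ∀ {v} t → v + t * a ∈ firstColumn (parts p) → v ∈ firstColumn (parts p)
  descend {v} zero    = subst (_∈ firstColumn (parts p)) (ℕ.+-identityʳ v)
  descend {v} (suc t) v∈ = closed v (descend t
    (subst (_∈ firstColumn (parts p)) (sym (ℕ.+-assoc v a (t * a))) v∈))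

-- Recovering a partition from the set of its first-column hook lengths.

firstColumn-sorted : ∀ {ps} → AllPairs _≥_ ps → AllPairs _>_ (firstColumn ps)
firstColumn-sorted []             = []
firstColumn-sorted (p≥ps ∷ dec) = firstColumn-< p≥ps ∷ firstColumn-sorted dec

firstColumn-positive : ∀ {ps} → All (0 <_) ps → 0 ∉ firstColumn ps
firstColumn-positive (0<p ∷ pos) (here eq)  = ℕ.<⇒≢ (ℕ.<-≤-trans 0<p (ℕ.m≤m+n _ _)) eq
firstColumn-positive (0<p ∷ pos) (there 0∈) = firstColumn-positive pos 0∈

firstColumn-injective : ∀ {ps qs} → firstColumn ps ≡ firstColumn qs → ps ≡ qs
firstColumn-injective {[]}     {[]}     eq = refl
firstColumn-injective {p ∷ ps} {q ∷ qs} eq with firstColumn-injective {ps} {qs} (List.∷-injectiveʳ eq)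
... | refl = cong (_∷ ps) (ℕ.+-cancelʳ-≡ (length ps) p q (List.∷-injectiveˡ eq))

-- Both heads are the maximum of the same set, and by strictness neither occurs again in its tail.
sorted-extensional : ∀ {xs ys} → AllPairs _>_ xs → AllPairs _>_ ys → (∀ v → v ∈ xs ⇔ v ∈ ys) → xs ≡ ys
sorted-extensional [] [] eq = refl
sorted-extensional [] (_∷_ {x = y} _ _) eq with Equivalence.from (eq y) (here refl)
... | ()
sorted-extensional (_∷_ {x = x} _ _) [] eq with Equivalence.to (eq x) (here refl)
... | ()
sorted-extensional {x ∷ xs} {y ∷ ys} (x>xs ∷ dxs) (y>ys ∷ dys) eq = cong₂ _∷_ x≡y
  (sorted-extensional dxs dys λ v → mk⇔
    (λ v∈ → tail (Equivalence.to (eq v) (there v∈)) λ v≡y → ℕ.<⇒≢ (All.lookup x>xs v∈) (trans v≡y (sym x≡y)))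
    (λ v∈ → tail (Equivalence.from (eq v) (there v∈)) λ v≡x → ℕ.<⇒≢ (All.lookup y>ys v∈) (trans v≡x x≡y)))
  where
  head-max : ∀ {z zs v} → All (z >_) zs → v ∈ z ∷ zs → v ≤ z
  head-max z>zs (here refl) = ℕ.≤-refl
  head-max z>zs (there v∈)  = ℕ.<⇒≤ (All.lookup z>zs v∈)
  x≡y : x ≡ y
  x≡y = ℕ.≤-antisym (head-max y>ys (Equivalence.to (eq x) (here refl)))
                    (head-max x>xs (Equivalence.from (eq y) (here refl)))
  tail : ∀ {v z zs} → v ∈ z ∷ zs → v ≢ z → v ∈ zs
  tail (here v≡z) v≢z = contradiction v≡z v≢z
  tail (there v∈) _   = v∈

fromFirstColumn : List ℕ → List ℕ
fromFirstColumn []       = []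
fromFirstColumn (h ∷ hs) = h ∸ length hs ∷ fromFirstColumn hs

length-fromFirstColumn : ∀ hs → length (fromFirstColumn hs) ≡ length hs
length-fromFirstColumn []       = refl
length-fromFirstColumn (h ∷ hs) = cong suc (length-fromFirstColumn hs)

-- `h` is the largest of `suc (length hs)` distinct positive numbers. Hence the subtraction in
-- `fromFirstColumn` never truncates, and the resulting parts are positive.
length< : ∀ {h hs} → AllPairs _>_ (h ∷ hs) → 0 ∉ h ∷ hs → length hs < h
length< {hs = []}     ((h>hs ∷ _)) 0∉ = ℕ.n≢0⇒n>0 λ h≡0 → 0∉ (here (sym h≡0))
length< {hs = _ ∷ _} ((h>h′ ∷ _) ∷ dec) 0∉ = ℕ.≤-<-trans (length< dec (0∉ ∘ there)) h>h′

firstColumn-fromFirstColumn : ∀ {hs} → AllPairs _>_ hs → 0 ∉ hs → firstColumn (fromFirstColumn hs) ≡ hs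
firstColumn-fromFirstColumn {[]}     _ _ = refl
firstColumn-fromFirstColumn {h ∷ hs} dec@(_ ∷ dec′) 0∉ = cong₂ _∷_
  (trans (cong (_+_ (h ∸ length hs)) (length-fromFirstColumn hs)) (ℕ.m∸n+n≡m (ℕ.<⇒≤ (length< dec 0∉))))
  (firstColumn-fromFirstColumn dec′ (0∉ ∘ there))

fromFirstColumn-positive : ∀ {hs} → AllPairs _>_ hs → 0 ∉ hs → All (0 <_) (fromFirstColumn hs)
fromFirstColumn-positive {[]}     _ _ = []
fromFirstColumn-positive {h ∷ hs} dec@(_ ∷ dec′) 0∉ =
  ℕ.m<n⇒0<n∸m (length< dec 0∉) ∷ fromFirstColumn-positive dec′ (0∉ ∘ there)

fromFirstColumn-decreasing : ∀ {hs} → AllPairs _>_ hs → Linked _≥_ (fromFirstColumn hs)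
fromFirstColumn-decreasing {[]}     _ = []
fromFirstColumn-decreasing {h ∷ []} _ = [-]
fromFirstColumn-decreasing {suc h ∷ h′ ∷ hs} ((s≤s h≥h′ ∷ _) ∷ dec) =
  -- The upper row subtracts one more than the next; strictness of the hook lengths makes up for it.
  ℕ.∸-monoˡ-≤ (length hs) h≥h′ ∷ fromFirstColumn-decreasing dec

module _ {X : ℕ → Set} (X? : Decidable X) {n} (X<n : ∀ {v} → X v → v < n) (0∉X : ¬ X 0) where

  private
    elements : List ℕ
    elements = filter X? (downFrom n)

    elements-sorted : AllPairs _>_ elements
    elements-sorted = AllPairs.filter⁺ X? (AllPairs.applyDownFrom⁺₁ _ n λ j<i _ → j<i)

    0∉elements : 0 ∉ elements
    0∉elements = 0∉X ∘ proj₂ ∘ ∈-filter⁻ X? {xs = downFrom n}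

  partitionOf : Partition
  partitionOf = record
    { parts      = fromFirstColumn elements
    ; decreasing = fromFirstColumn-decreasing elements-sorted
    ; positive   = fromFirstColumn-positive elements-sorted 0∉elements
    }

  ∈-firstColumn-partitionOf : ∀ v → v ∈ firstColumn (parts partitionOf) ⇔ X v
  ∈-firstColumn-partitionOf v rewrite firstColumn-fromFirstColumn elements-sorted 0∉elements =
    mk⇔ (proj₂ ∘ ∈-filter⁻ X? {xs = downFrom n}) (λ Xv → ∈-filter⁺ X? (∈-downFrom⁺ (X<n Xv)) Xv)

-- Residue counts

-- A set closed under subtraction of a meets the residue class of r in
-- r, r + a, …, r + (yᵣ - 1) a for some yᵣ.
record Profile {d} (X : ℕ → Set) (y : Vector ℕ (suc d)) : Set where
  constructor profile
  field
    ∈⇔< : ∀ r t → X (toℕ r + t * suc d) ⇔ t < y r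

open Profile

-- The threshold is the first failure of `P`, found by shifting `P` one place at a time; the failure
-- at `N` bounds the search.
threshold : ∀ {P : ℕ → Set} → Decidable P → (∀ t → P (suc t) → P t) →
  ∀ N → ¬ P N → ∃[ x ] (∀ t → P t ⇔ t < x)
threshold {P} P? P↓ zero ¬PN = 0 , λ t → mk⇔ (λ Pt → contradiction (down t Pt) ¬PN) (λ ())
  where
  down : ∀ t → P t → P 0
  down zero    Pt = Pt
  down (suc t) Pt = down t (P↓ t Pt)
threshold {P} P? P↓ (suc N) ¬PN with P? 0
... | no ¬P0 = threshold P? P↓ 0 ¬P0
... | yes P0 with threshold (P? ∘ suc) (P↓ ∘ suc) N ¬PN
...   | x , P⇔ = suc x , λ where
  zero    → mk⇔ (λ _ → z<s) (λ _ → P0)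
  (suc t) → mk⇔ (s≤s ∘ Equivalence.to (P⇔ t)) (Equivalence.from (P⇔ t) ∘ s<s⁻¹)

threshold-unique : ∀ {P : ℕ → Set} {x y} → (∀ t → P t ⇔ t < x) → (∀ t → P t ⇔ t < y) → x ≡ y
threshold-unique {x = x} {y} P⇔x P⇔y = ℕ.≤-antisym
  (ℕ.≮⇒≥ λ y<x → ℕ.<-irrefl refl (Equivalence.to (P⇔y y) (Equivalence.from (P⇔x y) y<x)))
  (ℕ.≮⇒≥ λ x<y → ℕ.<-irrefl refl (Equivalence.to (P⇔x x) (Equivalence.from (P⇔y x) x<y)))

profile-exists : ∀ {d X n} → Decidable X → (∀ {v} → X v → v < n) → ClosedUnder (suc d) X →
  ∃[ y ] Profile {d} X y
profile-exists {d} {X} {n} X? X<n closed = (λ r → proj₁ (count r)) , profile (λ r → proj₂ (count r))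
  where
  count : ∀ (r : Fin (suc d)) → ∃[ x ] (∀ t → X (toℕ r + t * suc d) ⇔ t < x)
  count r = threshold (λ t → X? (toℕ r + t * suc d))
    (λ t Xv → closed _ (subst X
      (ℕ-solve 3 (λ r t a → r ⊕ (a ⊕ t ⊗ a) ≐ (r ⊕ t ⊗ a) ⊕ a) refl (toℕ r) t (suc d)) Xv))
    -- The search may stop at `t = n`, because `r + n * a` is at least `n`.
    n (λ Xv → ℕ.<⇒≱ (X<n Xv) (ℕ.≤-trans (ℕ.m≤m*n n (suc d)) (ℕ.m≤n+m _ (toℕ r))))

module _ {d : ℕ} {X : ℕ → Set} {y : Vector ℕ (suc d)} (prof : Profile X y) where

  profile-zero : ¬ X 0 → y zero ≡ 0
  profile-zero ¬X0 = ℕ.n≤0⇒n≡0 (ℕ.≮⇒≥ (¬X0 ∘ Equivalence.from (∈⇔< prof zero 0)))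

  profile⇒closed : ClosedUnder (suc d) X
  profile⇒closed v Xv+a = subst X (sym (toℕ-mod+/* v d)) (Equivalence.from (∈⇔< prof r t)
    (ℕ.<-trans (ℕ.n<1+n t) (Equivalence.to (∈⇔< prof r (suc t)) (subst X eq Xv+a))))
    where
    r = v mod suc d
    t = v / suc d
    eq : v + suc d ≡ toℕ r + suc t * suc d
    eq = trans (cong (_+ suc d) (toℕ-mod+/* v d))
      (ℕ-solve 3 (λ r t a → (r ⊕ t ⊗ a) ⊕ a ≐ r ⊕ (a ⊕ t ⊗ a)) refl (toℕ r) t (suc d))

  module _ {m : ℕ} {k ℓ : Vector ℕ m} where

    -- If the inequality failed, the element of class `s` with quotient `k j + y r + e` would be in
    -- `X`. Subtracting b_j leaves the element of class `r` with quotient `y r`, the first one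
    -- missing.
    closed⇒Inequalities : (∀ j → ClosedUnder (suc d * k j + ℓ j) X) → ℕ-Inequalities k ℓ y
    closed⇒Inequalities closed j r s e eq = ℕ.≮⇒≥ λ k+yr+e<ys → ℕ.<-irrefl refl
      (Equivalence.to (∈⇔< prof r (y r)) (closed j _
        (subst X (sym (shift-residue r s (y r) eq)) (Equivalence.from (∈⇔< prof s _) k+yr+e<ys))))

    -- If `v` has quotient `t` in class `r`, then `v + b_j` in `X` means `k j + t + e < y s`; with
    -- the bound on `y s`, cancellation leaves `t < y r`.
    Inequalities⇒closed : ℕ-Inequalities k ℓ y → ∀ j → ClosedUnder (suc d * k j + ℓ j) X
    Inequalities⇒closed ineq j v Xv+b = subst X (sym (toℕ-mod+/* v d)) (Equivalence.from (∈⇔< prof r t)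
      (ℕ.+-cancelˡ-< (k j) t (y r) (ℕ.+-cancelʳ-< e (k j + t) (k j + y r) (ℕ.<-≤-trans
        (Equivalence.to (∈⇔< prof s (k j + t + e)) (subst X eq Xv+b))
        (ineq j r s e (toℕ-mod+/* (toℕ r + ℓ j) d))))))
      where
      r = v mod suc d
      t = v / suc d
      s = (toℕ r + ℓ j) mod suc d
      e = (toℕ r + ℓ j) / suc d
      eq : v + (suc d * k j + ℓ j) ≡ toℕ s + (k j + t + e) * suc d
      eq = trans (cong (_+ (suc d * k j + ℓ j)) (toℕ-mod+/* v d))
                 (shift-residue r s t (toℕ-mod+/* (toℕ r + ℓ j) d))

profile-unique : ∀ {d X} {y y′ : Vector ℕ (suc d)} → Profile X y → Profile X y′ → ∀ r → y r ≡ y′ r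
profile-unique prof prof′ r = threshold-unique (∈⇔< prof r) (∈⇔< prof′ r)

profile-determines : ∀ {d X X′} {y y′ : Vector ℕ (suc d)} → Profile X y → Profile X′ y′ →
  (∀ r → y r ≡ y′ r) → ∀ v → X v → X′ v
profile-determines {d} {X} {X′} prof prof′ y≡y′ v Xv =
  subst X′ (sym (toℕ-mod+/* v d)) (Equivalence.from (∈⇔< prof′ r t)
    (subst (t <_) (y≡y′ r) (Equivalence.to (∈⇔< prof r t) (subst X (toℕ-mod+/* v d) Xv))))
  where
  r = v mod suc d
  t = v / suc d

-- Finite sets with prescribed residue counts.

upperBound : ∀ {n} (y : Vector ℕ n) → ∃[ M ] (∀ i → y i ≤ M)
upperBound {zero}  y = 0 , λ ()
upperBound {suc n} y with upperBound (Vector.tail y)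
... | M , y≤M = y zero ⊔ M , λ where
  zero    → ℕ.m≤m⊔n (y zero) M
  (suc i) → ℕ.≤-trans (y≤M i) (ℕ.m≤n⊔m (y zero) M)

module _ {d : ℕ} (y : Vector ℕ (suc d)) where

  setOf : ℕ → Set
  setOf v = v / suc d < y (v mod suc d)

  setOf? : Decidable setOf
  setOf? v = v / suc d ℕ.<? y (v mod suc d)

  setOf-profile : Profile setOf y
  setOf-profile = profile ∈⇔
    where
    ∈⇔ : ∀ r t → setOf (toℕ r + t * suc d) ⇔ t < y r
    ∈⇔ r t rewrite mod-unique r t | div-unique r t = mk⇔ id id

  setOf-bounded : ∃[ n ] (∀ {v} → setOf v → v < n)
  setOf-bounded with upperBound y
  ... | M , y≤M = M * suc d , λ {v} v∈ → begin-strict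
    v                                                   ≡⟨ toℕ-mod+/* v d ⟩
    toℕ (v mod suc d) + v / suc d * suc d               <⟨ ℕ.+-monoˡ-< _ (Fin.toℕ<n (v mod suc d)) ⟩
    suc (v / suc d) * suc d                             ≤⟨ ℕ.*-monoˡ-≤ (suc d) (ℕ.≤-trans v∈ (y≤M (v mod suc d))) ⟩
    M * suc d                                           ∎
    where open ℕ.≤-Reasoning

-- The bijection between cores and integer points.

coordinates : ∀ {d} → Vector ℤ d → Vector ℕ (suc d)
coordinates z zero    = 0
coordinates z (suc i) = ℤ.∣ z i ∣

module _ {m d : ℕ} {k ℓ : Vector ℕ m} where

  private
    P = CorePolytope (suc d) k ℓ

  Inequalities⇒CorePolytope : ∀ {y} → y zero ≡ 0 → ℕ-Inequalities k ℓ y →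
    P (Vector.map fromℤ (+_ ∘ Vector.tail y))
  Inequalities⇒CorePolytope {y} y₀≡0 ineq = record
    { start = λ j i i≡ℓ → ℝ-≤-pointwise {x i} {fromℕ (k j)} λ _ → /1-mono-≤ (ℤ.+≤+
        (subst (y (suc i) ≤_) (trans (ℕ.+-identityʳ _) (trans (cong (_+_ (k j)) y₀≡0) (ℕ.+-identityʳ _)))
          (ineq j zero (suc i) 0 (trans (sym i≡ℓ) (sym (ℕ.+-identityʳ _))))))
    ; step  = λ j i _ i′ i′≡ → ℝ-≤-+-zero⁻¹ {x i′} {fromℕ (k j) ℝ.+ x i}
        (fromℕ-≤-+⁺ {y (suc i′)} (k j) (y (suc i)) 0
          (ineq j (suc i) (suc i′) 0 (trans (sym i′≡) (sym (ℕ.+-identityʳ _)))))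
    ; wrap  = λ j i a<i+ℓ i′ i′≡ → fromℕ-≤-+⁺ {y (suc i′)} (k j) (y (suc i)) 1
      (ineq j (suc i) (suc i′) 1 (begin
        index i + ℓ j                 ≡⟨ ℕ.m∸n+n≡m (ℕ.<⇒≤ a<i+ℓ) ⟨
        index i + ℓ j ∸ suc d + suc d ≡⟨ cong (_+ suc d) i′≡ ⟨
        index i′ + suc d              ≡⟨ cong (_+_ (index i′)) (ℕ.+-identityʳ (suc d)) ⟨
        index i′ + 1 * suc d          ∎))
    ; 0≤    = λ i → ℝ-≤-pointwise {0ℝ} {x i} λ _ → /1-mono-≤ {+ 0} {+ y (suc i)} (ℤ.+≤+ z≤n)
    }
    where
    open ≡-Reasoning
    x = Vector.map fromℤ (+_ ∘ Vector.tail y)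

  module _ {z : Vector ℤ d} (p : P (Vector.map fromℤ z)) where

    -- Nonnegativity in the polytope ensures that the absolute value in `coordinates` loses no sign.
    +-coordinates : ∀ i → + coordinates z (suc i) ≡ z i
    +-coordinates i = ℤ.0≤i⇒+∣i∣≡i (/1-cancel-≤ {+ 0} {z i}
      (ℝ-≤-constant⁻¹ {0ℝ} {fromℤ (z i)} (λ _ → refl) (λ _ → refl) (0≤ p i)))

    CorePolytope⇒ℕ-Inequalities : (∀ j → ℓ j < suc d) → ℕ-Inequalities k ℓ (coordinates z)
    CorePolytope⇒ℕ-Inequalities ℓ<a j r s e eq =
      fromℕ-≤-+⁻ {(0ℝ Vector.∷ Vector.map fromℤ z) s} {(0ℝ Vector.∷ Vector.map fromℤ z) r} (k j) e
        (seq-coordinates s) (seq-coordinates r) (CorePolytope⇒Inequalities ℓ<a p j r s e eq)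
      where
      seq-coordinates : ∀ r n → seq ((0ℝ Vector.∷ Vector.map fromℤ z) r) n ≡ (+ coordinates z r) ℚ./ 1
      seq-coordinates zero    n = refl
      seq-coordinates (suc i) n = cong (ℚ._/ 1) (sym (+-coordinates i))

module _ {m d : ℕ} {b k ℓ : Vector ℕ m}
         (b≡ : ∀ j → b j ≡ suc d * k j + ℓ j) (ℓ<a : ∀ j → ℓ j < suc d) where

  private
    P = CorePolytope (suc d) k ℓ
    Core = Σ Partition (IsMultiCore (suc d) b)

    X : Core → ℕ → Set
    X (p , _) v = v ∈ firstColumn (parts p)

    0∉X : ∀ c → ¬ X c 0
    0∉X (p , _) = firstColumn-positive (positive p)

    residueCounts : (c : Core) → ∃[ y ] Profile {d} (X c) y
    residueCounts (p , core-a , _) = profile-exists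
      (_∈? firstColumn (parts p))
      -- The strict bound is one more than the maximum, with 0 as the maximum of the empty list.
      (λ v∈ → s≤s (All.lookup (xs≤max 0 (firstColumn (parts p))) v∈))
      (isCore⇒closed p core-a)

    count : Core → Vector ℕ (suc d)
    count c = proj₁ (residueCounts c)

    count-zero : ∀ c → count c zero ≡ 0
    count-zero c = profile-zero (proj₂ (residueCounts c)) (0∉X c)

    toPoint : Core → IntegerPoint P
    toPoint c@(p , _ , core-b) = +_ ∘ Vector.tail (count c) ,
      Inequalities⇒CorePolytope (count-zero c) (closed⇒Inequalities (proj₂ (residueCounts c))
        λ j → subst (λ n → ClosedUnder n (X c)) (b≡ j) (isCore⇒closed p (core-b j)))

    -- The counts determine the set of first-column hook lengths, the set determines its decreasing
    -- list, and the list determines the parts.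
    toPoint-injective : ∀ {c c′} → (∀ i → proj₁ (toPoint c) i ≡ proj₁ (toPoint c′) i) →
      parts (proj₁ c) ≡ parts (proj₁ c′)
    toPoint-injective {c} {c′} z≡ = firstColumn-injective (sorted-extensional
      (firstColumn-sorted (sorted (proj₁ c))) (firstColumn-sorted (sorted (proj₁ c′)))
      λ v → mk⇔ (profile-determines (proj₂ (residueCounts c)) (proj₂ (residueCounts c′)) y≡ v)
                (profile-determines (proj₂ (residueCounts c′)) (proj₂ (residueCounts c)) (sym ∘ y≡) v))
      where
      y≡ : ∀ r → count c r ≡ count c′ r
      y≡ zero    = trans (count-zero c) (sym (count-zero c′))
      y≡ (suc i) = ℤ.+-injective (z≡ i)

    fromPoint : ∀ {z} → P (Vector.map fromℤ z) → ∃[ c ] Profile (X c) (coordinates z)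
    fromPoint {z} p = (λ′ , core-a , core-b) , prof
      where
      y = coordinates z
      -- Class 0 has count 0 by the definition of `coordinates`, so 0 is not in the set.
      λ′ = partitionOf (setOf? y) (proj₂ (setOf-bounded y)) (λ ())
      ∈⇔ = ∈-firstColumn-partitionOf (setOf? y) (proj₂ (setOf-bounded y)) (λ ())
      prof : Profile (_∈ firstColumn (parts λ′)) y
      prof = profile λ r t → mk⇔
        (Equivalence.to (∈⇔< (setOf-profile y) r t) ∘ Equivalence.to (∈⇔ _))
        (Equivalence.from (∈⇔ _) ∘ Equivalence.from (∈⇔< (setOf-profile y) r t))
      core-a = closed⇒isCore λ′ (profile⇒closed prof)
      core-b = λ j → closed⇒isCore λ′ (subst (λ n → ClosedUnder n (_∈ firstColumn (parts λ′))) (sym (b≡ j))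
        (Inequalities⇒closed prof (CorePolytope⇒ℕ-Inequalities {z = z} p ℓ<a) j))

  cores-bijection : Bijection (cores (suc d) b) (integerPoints P)
  cores-bijection = record
    { to        = toPoint
    -- `count` also receives the core proofs; since a set has only one profile, its values depend on
    -- the parts alone.
    ; cong      = λ {c} {c′} ps≡ i → cong +_ (profile-unique
        (proj₂ (residueCounts c))
        (subst (λ ps → Profile (_∈ firstColumn ps) (count c′)) (sym ps≡) (proj₂ (residueCounts c′)))
        (suc i))
    -- Surjectivity concerns every core `c′` with the parts of the constructed `c`; uniqueness of
    -- profiles identifies its counts with `coordinates z`.
    ; bijective = (λ {c} {c′} → toPoint-injective {c} {c′}) , λ (z , p) →
        let c , prof = fromPoint {z} p in c , λ {c′} ps≡ i → trans
          (cong +_ (profile-unique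
            (subst (λ ps → Profile (_∈ firstColumn ps) (count c′)) ps≡ (proj₂ (residueCounts c′)))
            prof (suc i)))
          (+-coordinates {z = z} p i)
    }

proposition4p1 : (m a : ℕ) (b k ℓ : Vector ℕ m) →
    1 ≤ m → 1 ≤ a → (∀ j → 1 ≤ b j) →
    gcdAll a b ≡ 1 →
    (∀ j → b j ≡ a * k j + ℓ j) →
    (∀ j → 1 ≤ ℓ j × ℓ j < a) →
    IsPolytope (CorePolytope a k ℓ) ×
    Bijection (cores a b) (integerPoints (CorePolytope a k ℓ))
-- The case `a = 0` is empty by `1 ≤ a`.
proposition4p1 m (suc d) b k ℓ _ _ _ gcd≡1 b≡ ℓ-range =
  (isPolyhedron (suc d) k ℓ , isBounded gcd≡1 b≡ (proj₂ ∘ ℓ-range)) ,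
  cores-bijection b≡ (proj₂ ∘ ℓ-range)
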